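{- Let $H$ be a graph. Then: (a) if $H$ is (isomorphic to) an induced subgraph of $P_4$ or of $K_{1,3}+sP_1$ for some $s\geq 0$, then the class of $H$-free $3$-colourable graphs is ioct-bounded; and (b) if the class of $H$-free $3$-colourable graphs is ioct-bounded, then $H$ is (isomorphic to) an induced subgraph of $K_{1,4}^+$ or of $K_{1,4}+sP_1$ for some $s\geq 0$.
   Context: Graphs are finite, simple and undirected. A graph is $H$-free if it has no induced subgraph isomorphic to $H$. $G+H$ is the disjoint union and $sG$ is the disjoint union of $s$ copies of $G$. $P_n$ is the path on $n$ vertices. $K_{1,r}$ is the star with $r$ leaves, and $K_{1,r}^+$ is the graph obtained from $K_{1,r}$ by subdividing one edge once. An odd cycle transversal of $G$ is a set $S\subseteq V(G)$ such that $G-S$ is bipartite; it is independent if $S$ is an independent set. A graph has an independent odd cycle transversal if and only if it is $3$-colourable. For a $3$-colourable graph $G$, $\mathrm{oct}(G)$ is the minimum size of an odd cycle transversal and $\mathrm{ioct}(G)$ is the minimum size of an independent odd cycle transversal. A class $\mathcal X$ of $3$-colourable graphs is ioct-bounded if there is a function $f:\mathbb{Z}_{\geq 0}\to\mathbb{Z}_{\geq 0}$ such that $\mathrm{ioct}(G)\leq f(\mathrm{oct}(G))$ for every $G\in\mathcal X$. -}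

module Defs where

open import Data.Empty using (⊥)
open import Data.Fin.Base using (Fin; zero; suc; toℕ)
open import Data.Fin.Properties using () renaming (_≟_ to _≟ᶠ_)
open import Data.Fin.Subset using (Subset; _∈_; _∉_; ∣_∣)
open import Data.Maybe.Base using (Maybe; just; nothing)
open import Data.Nat.Base using (ℕ; suc; _≤_; NonZero)
open import Data.Nat.Properties using (1+n≢n) renaming (_≟_ to _≟ⁿ_)
open import Data.Product.Base using (_×_; _,_; ∃; ∃-syntax; proj₁; proj₂)
import Data.Product.Relation.Binary.Pointwise.NonDependent as ×
open import Data.Sum.Base using (_⊎_; inj₁; inj₂; [_,_]; swap)
import Data.Sum.Relation.Binary.Pointwise as ⊎
open import Function.Base using (_on_; _∘_)
open import Function.Bundles using (_⇔_)
open import Function.Definitions using (Injective)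
open import Level using (0ℓ)
open import Relation.Binary.Core using (Rel)
open import Relation.Binary.Definitions
  using (Symmetric; Irreflexive; Decidable; DecidableEquality)
open import Relation.Binary.PropositionalEquality
  using (_≡_; _≢_; refl; sym; cong)
open import Relation.Nullary.Decidable using (yes; no; ¬?; _×-dec_; _⊎-dec_)
open import Relation.Nullary.Negation using (¬_)
open import Relation.Unary using (Pred)

-- Simple undirected graphs on an arbitrary vertex type.  The finite graphs
-- being quantified over are those of type Graph (Fin n): up to isomorphism
-- these are all of them.
record Graph (V : Set) : Set₁ where
  infix 4 _~_
  field
    _~_      : Rel V 0ℓ
    ~-sym    : Symmetric _~_
    ~-irrefl : Irreflexive _≡_ _~_
    _~?_     : Decidable _~_

open Graph

infixr 6 _+ᴳ_
infixl 6 _-ᴳ_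
infix  4 _⊴_

-- H ⊴ G: H is isomorphic to an induced subgraph of G (the image of f).
_⊴_ : ∀ {U V} → Graph U → Graph V → Set
_⊴_ {U} {V} H G =
  ∃[ f ] (Injective _≡_ _≡_ f × (∀ (u v : U) → _~_ H u v ⇔ _~_ G (f u) (f v)))

_-Free : ∀ {U V} → Graph U → Graph V → Set
(H -Free) G = ¬ (H ⊴ G)

Colourable : ∀ {V} → ℕ → Graph V → Set
Colourable {V} k G =
  ∃ λ (c : V → Fin k) → ∀ u v → _~_ G u v → c u ≢ c v

Bipartite : ∀ {V} → Graph V → Set
Bipartite = Colourable 2

_-ᴳ_ : ∀ {n} → Graph (Fin n) → (S : Subset n) → Graph (∃ (_∉ S))
(G -ᴳ S) ._~_          = _~_ G on proj₁
(G -ᴳ S) .~-sym        = ~-sym G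
(G -ᴳ S) .~-irrefl p≡q = ~-irrefl G (cong proj₁ p≡q)
(G -ᴳ S) ._~?_ (u , _) (v , _) = _~?_ G u v

_+ᴳ_ : ∀ {U V} → Graph U → Graph V → Graph (U ⊎ V)
(G +ᴳ H) ._~_   = ⊎.Pointwise (_~_ G) (_~_ H)
(G +ᴳ H) .~-sym = ⊎.⊎-symmetric (~-sym G) (~-sym H)
(G +ᴳ H) .~-irrefl refl (⊎.inj₁ x~x) = ~-irrefl G refl x~x
(G +ᴳ H) .~-irrefl refl (⊎.inj₂ x~x) = ~-irrefl H refl x~x
(G +ᴳ H) ._~?_  = ⊎.⊎-decidable (_~?_ G) (_~?_ H)

copies : ∀ {V} (s : ℕ) → Graph V → Graph (Fin s × V)
copies s G ._~_   = ×.Pointwise _≡_ (_~_ G)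
copies s G .~-sym (i≡j , u~v) = sym i≡j , ~-sym G u~v
copies s G .~-irrefl p≡q (_ , u~v) = ~-irrefl G (cong proj₂ p≡q) u~v
copies s G ._~?_  = ×.×-decidable _≟ᶠ_ (_~?_ G)

path : (n : ℕ) → Graph (Fin n)
path n ._~_ i j = toℕ j ≡ suc (toℕ i) ⊎ toℕ i ≡ suc (toℕ j)
path n .~-sym   = swap
path n .~-irrefl refl = [ 1+n≢n ∘ sym , 1+n≢n ∘ sym ]
path n ._~?_ i j = (toℕ j ≟ⁿ suc (toℕ i)) ⊎-dec (toℕ i ≟ⁿ suc (toℕ j))

data StarAdj {r : ℕ} : Rel (Fin (suc r)) 0ℓ where
  centre-leaf : ∀ i → StarAdj zero (suc i)
  leaf-centre : ∀ i → StarAdj (suc i) zero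

star : (r : ℕ) → Graph (Fin (suc r))
star r ._~_ = StarAdj
star r .~-sym (centre-leaf i) = leaf-centre i
star r .~-sym (leaf-centre i) = centre-leaf i
star r .~-irrefl refl ()
star r ._~?_ zero    zero    = no λ ()
star r ._~?_ zero    (suc j) = yes (centre-leaf j)
star r ._~?_ (suc i) zero    = yes (leaf-centre i)
star r ._~?_ (suc i) (suc j) = no λ ()

-- Subdivide the edge ab once; nothing is the new vertex.
module _ {V : Set} (_≟_ : DecidableEquality V) (G : Graph V) {a b : V} where

  private
    Adj : Rel (Maybe V) 0ℓ
    Adj (just x) (just y) =
      _~_ G x y × ¬ ((x ≡ a × y ≡ b) ⊎ (x ≡ b × y ≡ a))
    Adj (just x) nothing  = x ≡ a ⊎ x ≡ b
    Adj nothing  (just y) = y ≡ a ⊎ y ≡ b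
    Adj nothing  nothing  = ⊥

    Adj-sym : Symmetric Adj
    Adj-sym {just x}  {just y}  (x~y , xy≢ab) =
      ~-sym G x~y ,
      λ { (inj₁ (y≡a , x≡b)) → xy≢ab (inj₂ (x≡b , y≡a))
        ; (inj₂ (y≡b , x≡a)) → xy≢ab (inj₁ (x≡a , y≡b)) }
    Adj-sym {just x}  {nothing} p = p
    Adj-sym {nothing} {just y}  p = p

    Adj-irrefl : Irreflexive _≡_ Adj
    Adj-irrefl {just x} refl (x~x , _) = ~-irrefl G refl x~x

    Adj? : Decidable Adj
    Adj? (just x) (just y) =
      _~?_ G x y
        ×-dec ¬? (((x ≟ a) ×-dec (y ≟ b)) ⊎-dec ((x ≟ b) ×-dec (y ≟ a)))
    Adj? (just x) nothing  = (x ≟ a) ⊎-dec (x ≟ b)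
    Adj? nothing  (just y) = (y ≟ a) ⊎-dec (y ≟ b)
    Adj? nothing  nothing  = no λ ()

  subdivide : _~_ G a b → Graph (Maybe V)
  subdivide _ = record
    { _~_ = Adj ; ~-sym = Adj-sym ; ~-irrefl = Adj-irrefl ; _~?_ = Adj? }

-- K₁,ᵣ⁺: all edges of the star are equivalent, so which one is subdivided is
-- immaterial.
star⁺ : (r : ℕ) .{{_ : NonZero r}} → Graph (Maybe (Fin (suc r)))
star⁺ (suc r) = subdivide _≟ᶠ_ (star (suc r)) (centre-leaf zero)

module _ {n : ℕ} (G : Graph (Fin n)) where

  Independent : Pred (Subset n) 0ℓ
  Independent S = ∀ u v → u ∈ S → v ∈ S → ¬ _~_ G u v

  OddCycleTransversal : Pred (Subset n) 0ℓ
  OddCycleTransversal S = Bipartite (G -ᴳ S)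

  IndependentOddCycleTransversal : Pred (Subset n) 0ℓ
  IndependentOddCycleTransversal S = Independent S × OddCycleTransversal S

IsMinSize : ∀ {n} → Pred (Subset n) 0ℓ → ℕ → Set
IsMinSize P k = (∃[ S ] (P S × ∣ S ∣ ≡ k)) × (∀ S → P S → k ≤ ∣ S ∣)

-- IsOct G k reads oct(G) = k, and IsIoct G l reads ioct(G) = l.
IsOct IsIoct : ∀ {n} → Graph (Fin n) → ℕ → Set
IsOct  G = IsMinSize (OddCycleTransversal G)
IsIoct G = IsMinSize (IndependentOddCycleTransversal G)

GraphClass : Set₁
GraphClass = ∀ {n} → Graph (Fin n) → Set

FreeThreeColourable : ∀ {U} → Graph U → GraphClass
FreeThreeColourable H G = (H -Free) G × Colourable 3 G

-- On a 3-colourable graph both minima exist, and they are unique, so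
-- quantifying over their values k and l loses nothing.
IoctBounded : GraphClass → Set₁
IoctBounded 𝒳 =
  ∃ λ (f : ℕ → ℕ) → ∀ {n} (G : Graph (Fin n)) → 𝒳 G →
    ∀ {k l} → IsOct G k → IsIoct G l → l ≤ f k

-- (a) A bound on ioct is obtained by recolouring: given a 3-colouring and an odd
-- cycle transversal S of size k, find a 3-colouring with a class bounded in k.
-- For P₄-free graphs Seinsche's theorem allows an induction over disjoint unions
-- and joins; in a join the colours are shared out between the two sides, so
-- deleting S saves a colour on one of them.  In a (K₁,₃ + sP₁)-free graph a
-- vertex with three neighbours in an independent set I (a heavy vertex) misses at
-- most s vertices of I.  Either the bipartite graph G - S is dense, and then two
-- of the three colours can be merged on one of its sides, or after enlarging S by
-- a bounded number of vertices it has maximum degree 2.  Then all but boundedly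
-- many of its vertices see exactly the vertices of S that are heavy to their
-- side, and they can be recoloured with one main colour per side, using a third
-- colour only near the exceptional vertices.
--
-- (b) Four families of graphs with bounded oct and unbounded ioct avoid,
-- respectively, K₃; 2P₂, P₄ + P₁ and C₅; C₄ and adjacent claws; K₁,₅.  A graph H
-- containing none of these either contains a P₄, which then dominates it and makes
-- it a double star, or is a star with isolated vertices.

module Submission where

open import Defs
open Graph
open import Data.Bool.Base using (Bool; true; false; not; _∨_; _∧_; if_then_else_)
open import Data.Bool.Properties using (∧-comm; ¬-not) renaming (_≟_ to _≟ᵇ_)
open import Data.Empty using (⊥; ⊥-elim)
open import Data.Fin.Base using (Fin; zero; suc; toℕ; fromℕ<; inject₁; inject≤; splitAt; join; combine; remQuot; _↑ˡ_; _↑ʳ_) renaming (_<_ to _<ᶠ_)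
open import Data.Fin.Induction using (<-weakInduction)
open import Data.Fin.Patterns using (0F; 1F; 2F; 3F; 4F; 5F)
open import Data.Fin.Properties using (any?; all?; suc-injective; toℕ<n; toℕ-injective; toℕ-fromℕ<; fromℕ<-injective; toℕ-inject₁; inject₁-injective; inject≤-injective; injective⇒≤; splitAt-join; join-splitAt; remQuot-combine; combine-remQuot) renaming (_≟_ to _≟ᶠ_; <-cmp to <ᶠ-cmp)
open import Data.Fin.Subset using (Subset; ∣_∣) renaming (_∈_ to _∈ˢ_; _∉_ to _∉ˢ_)
open import Data.Fin.Subset.Properties using () renaming (_∈?_ to _∈ˢ?_)
open import Data.List.Base using (List; []; _∷_; _++_; length; map; filter; allFin)
open import Data.List.Membership.Propositional using (_∈_; _∉_; lose)
open import Data.List.Membership.Propositional.Properties using (∈-++⁺ˡ; ∈-++⁺ʳ; ∈-map⁺; ∈-filter⁺; ∈-filter⁻; ∈-allFin)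
open import Data.List.Membership.Setoid.Properties using (index-injective)
open import Data.List.Properties using (length-++; length-map; length-tabulate; length-filter; filter-notAll)
open import Data.List.Relation.Unary.All.Properties using (All¬⇒¬Any)
open import Data.List.Relation.Unary.AllPairs using ([]; _∷_)
open import Data.List.Relation.Unary.Any using (here; there; index)
open import Data.List.Relation.Unary.Unique.Propositional using (Unique)
open import Data.List.Relation.Unary.Unique.Propositional.Properties using (filter⁺; allFin⁺)
open import Data.Maybe.Base using (Maybe; just; nothing)
open import Data.Maybe.Properties using (just-injective) renaming (≡-dec to maybe-≟)
open import Data.Nat.Base using (ℕ; zero; suc; _+_; _*_; _≤_; _<_; _⊔_; _≡ᵇ_; z≤n; s≤s; s≤s⁻¹)
open import Data.Nat.Properties hiding (suc-injective)
import Data.Nat.Properties as ℕ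
open import Data.Product.Base using (_×_; _,_; ∃; ∃-syntax; proj₁; proj₂)
open import Data.Sum.Base as Sum using (_⊎_; inj₁; inj₂; [_,_])
open import Data.Sum.Properties using (inj₁-injective; inj₂-injective)
import Data.Sum.Relation.Binary.Pointwise as ⊎
open import Data.Unit.Base using (⊤; tt)
open import Data.Vec.Base using ([]; _∷_; here; there; lookup; tabulate)
open import Data.Vec.Properties using (lookup∘tabulate; []=⇒lookup; lookup⇒[]=)
open import Function.Base using (_∘_; id; _∋_)
open import Function.Bundles using (_⇔_; mk⇔; Equivalence)
open import Function.Definitions using (Injective)
open import Level using (0ℓ)
open import Relation.Binary.Core using (Rel)
import Relation.Binary.Definitions as B
open import Relation.Binary.PropositionalEquality using (_≡_; _≢_; refl; sym; trans; cong; subst; subst₂; setoid; ≢-sym)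
open import Relation.Nullary using (¬_; Dec; yes; no; contradiction)
open import Relation.Nullary.Decidable using (does; dec-true; dec-false; ¬?; _×-dec_; _⊎-dec_; _→-dec_; decidable-stable; from-yes; map′; True; toWitness)
open import Relation.Unary using (Pred; Decidable)

-- In the P₄-free induction the number of colours has to vary, because a join splits it between its
-- two sides; only at the end is it set to three against two. In the sparse case the obstacle is a
-- short path between two exceptional vertices, which leaves no room to pass from the old colours to
-- the main ones. Such a gap keeps its old colours. This is affordable because every gap vertex on a
-- side is next to an exceptional vertex, and degree at most 2 bounds the number of those
-- neighbours. A longer path needs the third colour only at its first vertex. Which colours are
-- usable depends, away from the exceptional vertices, on the side alone. The choice of the main
-- colours is therefore a question about six Booleans. The families in (b) share one shape: a core
-- of fixed size whose removal leaves a bipartite graph, and `N` layers. The core constrains every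
-- 3-colouring so that each of its classes meets each layer.

-- Sizes by covering lists and injections; colour classes as transversals.

⊴-trans : ∀ {U V W} {F : Graph U} {G : Graph V} {H : Graph W} → F ⊴ G → G ⊴ H → F ⊴ H
⊴-trans (f , f-inj , f-adj) (g , g-inj , g-adj) =
  g ∘ f , f-inj ∘ g-inj ,
  λ u v → mk⇔ (Equivalence.to (g-adj (f u) (f v)) ∘ Equivalence.to (f-adj u v))
              (Equivalence.from (f-adj u v) ∘ Equivalence.from (g-adj (f u) (f v)))

-- A covering list may repeat elements and contain foreign ones, so bounds pass to subsets and
-- unions without any decidability.
AtMost : ∀ {V : Set} → ℕ → Pred V 0ℓ → Set
AtMost {V} m P = ∃[ xs ] (length xs ≤ m × (∀ v → P v → v ∈ xs))

module _ {V : Set} where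

  atMost-⊆ : ∀ {m} {P Q : Pred V 0ℓ} → (∀ v → P v → Q v) → AtMost m Q → AtMost m P
  atMost-⊆ P⊆Q (xs , le , cov) = xs , le , λ v Pv → cov v (P⊆Q v Pv)

  atMost-≤ : ∀ {m m′} {P : Pred V 0ℓ} → m ≤ m′ → AtMost m P → AtMost m′ P
  atMost-≤ m≤m′ (xs , le , cov) = xs , ≤-trans le m≤m′ , cov

  atMost-∪ : ∀ {m m′} {P Q : Pred V 0ℓ} → AtMost m P → AtMost m′ Q →
             AtMost (m + m′) (λ v → P v ⊎ Q v)
  atMost-∪ (xs , le , cov) (xs′ , le′ , cov′) =
    xs ++ xs′ , subst (_≤ _) (sym (length-++ xs)) (+-mono-≤ le le′) ,
    λ v → [ ∈-++⁺ˡ ∘ cov v , ∈-++⁺ʳ xs ∘ cov′ v ]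

  atMost-∅ : ∀ {m} {P : Pred V 0ℓ} → (∀ v → ¬ P v) → AtMost m P
  atMost-∅ ¬P = [] , z≤n , λ v Pv → ⊥-elim (¬P v Pv)

  atMost-⋃ : ∀ {U : Set} {m k} {P : Pred U 0ℓ} (R : U → Pred V 0ℓ) →
             AtMost m P → (∀ u → AtMost k (R u)) →
             AtMost (m * k) (λ v → ∃[ u ] (P u × R u v))
  atMost-⋃ {U} {m} {k} R (us , le , cov) each =
    atMost-≤ (*-monoˡ-≤ k le) (atMost-⊆ (λ { v (u , Pu , Ruv) → u , cov u Pu , Ruv }) (union us))
    where
    union : ∀ us → AtMost (length us * k) (λ v → ∃[ u ] (u ∈ us × R u v))
    union []       = atMost-∅ λ { _ (_ , () , _) }
    union (u ∷ us) = atMost-⊆ (λ { v (_ , here refl , Ruv) → inj₁ Ruv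
                                 ; v (w , there w∈us , Rwv) → inj₂ (w , w∈us , Rwv) })
                              (atMost-∪ (each u) (union us))

  injective⇒≤length : ∀ {m} {xs : List V} (f : Fin m → V) → Injective _≡_ _≡_ f → (∀ i → f i ∈ xs) → m ≤ length xs
  injective⇒≤length f f-inj f∈ =
    injective⇒≤ {f = index ∘ f∈} λ {i} {j} eq → f-inj (index-injective (setoid V) (f∈ i) (f∈ j) eq)

  Many : ℕ → Pred V 0ℓ → Set
  Many m P = ∃ λ (f : Fin m → V) → Injective _≡_ _≡_ f × (∀ i → P (f i))

  ¬atMost∧many : ∀ {m} {P : Pred V 0ℓ} → AtMost m P → ¬ Many (suc m) P
  ¬atMost∧many (xs , le , cov) (f , f-inj , Pf) =
    <⇒≱ (injective⇒≤length f f-inj (λ i → cov (f i) (Pf i))) le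

  many₃ : ∀ {P : Pred V 0ℓ} {x y z} → x ≢ y → x ≢ z → y ≢ z → P x → P y → P z → Many 3 P
  many₃ {P} {x} {y} {z} x≢y x≢z y≢z Px Py Pz = f , inj , Pf
    where
    f : Fin 3 → V
    f zero = x
    f (suc zero) = y
    f (suc (suc zero)) = z
    inj : Injective _≡_ _≡_ f
    inj {zero} {zero} _ = refl
    inj {zero} {suc zero} e = ⊥-elim (x≢y e)
    inj {zero} {suc (suc zero)} e = ⊥-elim (x≢z e)
    inj {suc zero} {zero} e = ⊥-elim (x≢y (sym e))
    inj {suc zero} {suc zero} _ = refl
    inj {suc zero} {suc (suc zero)} e = ⊥-elim (y≢z e)
    inj {suc (suc zero)} {zero} e = ⊥-elim (x≢z (sym e))
    inj {suc (suc zero)} {suc zero} e = ⊥-elim (y≢z (sym e))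
    inj {suc (suc zero)} {suc (suc zero)} _ = refl
    Pf : ∀ i → P (f i)
    Pf zero = Px
    Pf (suc zero) = Py
    Pf (suc (suc zero)) = Pz

  unique-lookup : ∀ {m} {xs : List V} → Unique xs → m ≤ length xs → Many m (_∈ xs)
  unique-lookup {zero}  _ _ = (λ ()) , (λ { {()} }) , λ ()
  unique-lookup {suc m} {x ∷ xs} (x∉ ∷ xs!) (s≤s m≤) with unique-lookup xs! m≤
  ... | f , f-inj , f∈ = g , g-inj , g∈
    where
    g : Fin (suc m) → V
    g zero    = x
    g (suc i) = f i
    x≢f : ∀ i → x ≢ f i
    x≢f i e = All¬⇒¬Any x∉ (subst (_∈ xs) (sym e) (f∈ i))
    g-inj : Injective _≡_ _≡_ g
    g-inj {zero}  {zero}  _ = refl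
    g-inj {zero}  {suc j} e = ⊥-elim (x≢f j e)
    g-inj {suc i} {zero}  e = ⊥-elim (x≢f i (sym e))
    g-inj {suc i} {suc j} e = cong suc (f-inj e)
    g∈ : ∀ i → g i ∈ (x ∷ xs)
    g∈ zero    = here refl
    g∈ (suc i) = there (f∈ i)

atMost⊎many : ∀ {n} {P : Pred (Fin n) 0ℓ} → Decidable P → ∀ m → AtMost m P ⊎ Many (suc m) P
atMost⊎many {n} {P} P? m with ≤-<-connex (length (filter P? (allFin n))) m
... | inj₁ le = inj₁ (filter P? (allFin n) , le , λ v Pv → ∈-filter⁺ P? (∈-allFin v) Pv)
... | inj₂ gt with unique-lookup (filter⁺ P? (allFin⁺ n)) gt
...   | f , f-inj , f∈ = inj₂ (f , f-inj , λ i → proj₂ (∈-filter⁻ P? {xs = allFin n} (f∈ i)))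

⟦_⟧ : ∀ {n} {P : Pred (Fin n) 0ℓ} → Decidable P → Subset n
⟦ P? ⟧ = tabulate (does ∘ P?)

module _ {n : ℕ} {P : Pred (Fin n) 0ℓ} (P? : Decidable P) where

  ∈-⟦⟧⁺ : ∀ {v} → P v → v ∈ˢ ⟦ P? ⟧
  ∈-⟦⟧⁺ {v} Pv = lookup⇒[]= v _ (trans (lookup∘tabulate _ v) (dec-true (P? v) Pv))

  ∈-⟦⟧⁻ : ∀ {v} → v ∈ˢ ⟦ P? ⟧ → P v
  ∈-⟦⟧⁻ {v} v∈ with P? v in eq
  ... | yes Pv = Pv
  ... | no _ with () ← trans (sym ([]=⇒lookup v∈)) (trans (lookup∘tabulate _ v) (cong does eq))

atMost-∈ : ∀ {n} (S : Subset n) → AtMost ∣ S ∣ (_∈ˢ S)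
atMost-∈ []          = atMost-∅ λ { _ () }
atMost-∈ (true  ∷ S) with atMost-∈ S
... | xs , le , cov = zero ∷ map suc xs , s≤s (subst (_≤ _) (sym (length-map suc xs)) le) ,
  λ { zero _ → here refl ; (suc v) (there v∈S) → there (∈-map⁺ suc (cov v v∈S)) }
atMost-∈ (false ∷ S) with atMost-∈ S
... | xs , le , cov = map suc xs , subst (_≤ _) (sym (length-map suc xs)) le ,
  λ { (suc v) (there v∈S) → ∈-map⁺ suc (cov v v∈S) }

many-∈ : ∀ {n} (S : Subset n) → Many ∣ S ∣ (_∈ˢ S)
many-∈ []          = (λ ()) , (λ { {()} }) , λ ()
many-∈ (true  ∷ S) with many-∈ S
... | f , f-inj , f∈ =
  (λ { zero → zero ; (suc i) → suc (f i) }) ,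
  (λ { {zero} {zero} _ → refl ; {suc i} {suc j} e → cong suc (f-inj (suc-injective e)) }) ,
  λ { zero → here ; (suc i) → there (f∈ i) }
many-∈ (false ∷ S) with many-∈ S
... | f , f-inj , f∈ =
  suc ∘ f , f-inj ∘ suc-injective , λ i → there (f∈ i)

∣S∣≤ : ∀ {n m} (S : Subset n) → AtMost m (_∈ˢ S) → ∣ S ∣ ≤ m
∣S∣≤ S (xs , le , cov) with many-∈ S
... | f , f-inj , f∈ = ≤-trans (injective⇒≤length f f-inj (λ i → cov (f i) (f∈ i))) le

Proper : ∀ {V C : Set} → Graph V → (V → C) → Set
Proper G c = ∀ u v → _~_ G u v → c u ≢ c v

colours∖ : ∀ (i : Fin 3) → ∃ λ (e : Fin 3 → Fin 2) → ∀ x y → x ≢ i → y ≢ i → e x ≡ e y → x ≡ y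
colours∖ zero = (λ { zero → zero ; (suc x) → x }) ,
  λ { zero _ x≢ _ _ → ⊥-elim (x≢ refl) ; _ zero _ y≢ _ → ⊥-elim (y≢ refl) ; (suc x) (suc y) _ _ e → cong suc e }
colours∖ (suc zero) = (λ { zero → zero ; (suc _) → suc zero }) ,
  λ { zero zero _ _ _ → refl
    ; (suc zero) _ x≢ _ _ → ⊥-elim (x≢ refl)
    ; _ (suc zero) _ y≢ _ → ⊥-elim (y≢ refl)
    ; (suc (suc zero)) (suc (suc zero)) _ _ _ → refl }
colours∖ (suc (suc zero)) = (λ { zero → zero ; (suc _) → suc zero }) ,
  λ { zero zero _ _ _ → refl
    ; (suc (suc zero)) _ x≢ _ _ → ⊥-elim (x≢ refl)
    ; _ (suc (suc zero)) _ y≢ _ → ⊥-elim (y≢ refl)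
    ; (suc zero) (suc zero) _ _ _ → refl }

Recolourable : ∀ {n} → Graph (Fin n) → ℕ → Set
Recolourable {n} G m =
  ∃ λ (c : Fin n → Fin 3) → Proper G c × ∃[ i ] AtMost m (λ v → c v ≡ i)

recolourable-≤ : ∀ {n} {G : Graph (Fin n)} {m m′} → m ≤ m′ → Recolourable G m → Recolourable G m′
recolourable-≤ m≤m′ (c , proper , i , few) = c , proper , i , atMost-≤ m≤m′ few

module _ {n : ℕ} (G : Graph (Fin n)) where

  class-ioct : ∀ {c : Fin n → Fin 3} → Proper G c → ∀ i →
               IndependentOddCycleTransversal G ⟦ (λ v → c v ≟ᶠ i) ⟧
  class-ioct {c} proper i with colours∖ i
  ... | e , e-inj =
    (λ u v u∈ v∈ u~v → proper u v u~v (trans (∈-⟦⟧⁻ class? u∈) (sym (∈-⟦⟧⁻ class? v∈)))) ,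
    (λ { (v , _) → e (c v) }) ,
    λ { (u , u∉) (v , v∉) u~v eq →
        proper u v u~v (e-inj (c u) (c v) (u∉ ∘ ∈-⟦⟧⁺ class?) (v∉ ∘ ∈-⟦⟧⁺ class?) eq) }
    where
    class? : Decidable (λ v → c v ≡ i)
    class? v = c v ≟ᶠ i

  recolourable⇒ioct≤ : ∀ {l m} → IsIoct G l → Recolourable G m → l ≤ m
  recolourable⇒ioct≤ (_ , min) (c , proper , i , few) =
    ≤-trans (min _ (class-ioct proper i))
            (∣S∣≤ _ (atMost-⊆ (λ v → ∈-⟦⟧⁻ (λ w → c w ≟ᶠ i)) few))

-- P₄-free graphs

rank : (ℕ → Bool) → ℕ → ℕ
rank D zero    = zero
rank D (suc i) = if D i then suc (rank D i) else rank D i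

rank-≤suc : ∀ D i → rank D i ≤ rank D (suc i)
rank-≤suc D i with D i
... | true  = n≤1+n _
... | false = ≤-refl

rank-mono : ∀ D {i j} → i ≤ j → rank D i ≤ rank D j
rank-mono D {i} {zero}  z≤n = ≤-refl
rank-mono D {i} {suc j} i≤ with m≤n⇒m<n∨m≡n i≤
... | inj₁ i<   = ≤-trans (rank-mono D (s≤s⁻¹ i<)) (rank-≤suc D j)
... | inj₂ refl = ≤-refl

rank-< : ∀ D {i j} → D i ≡ true → i < j → rank D i < rank D j
rank-< D {i} Di i<j = ≤-trans (≤-reflexive step) (rank-mono D i<j)
  where
  step : suc (rank D i) ≡ rank D (suc i)
  step rewrite Di = refl

rank-injective : ∀ D {i j} → D i ≡ true → D j ≡ true → rank D i ≡ rank D j → i ≡ j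
rank-injective D {i} {j} Di Dj eq with <-cmp i j
... | B.tri< i<j _ _ = contradiction eq (<⇒≢ (rank-< D Di i<j))
... | B.tri≈ _ i≡j _ = i≡j
... | B.tri> _ _ j<i = contradiction (sym eq) (<⇒≢ (rank-< D Dj j<i))

rank-complement : ∀ D q → rank D q + rank (not ∘ D) q ≡ q
rank-complement D zero = refl
rank-complement D (suc q) with D q
... | true  = cong suc (rank-complement D q)
... | false = trans (+-suc _ _) (cong suc (rank-complement D q))

private
  variable
    n : ℕ

module _ {V : Set} where

  -- For symmetric `R` the pattern itself forces the four vertices apart: `a ≡ c`, say, would turn
  -- the edge `R c d` into `R a d`.
  NoP₄ : Rel V 0ℓ → Set
  NoP₄ R = ∀ {a b c d} → R a b → R b c → R c d → ¬ R a c → ¬ R b d → ¬ R a d → ⊥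

  Complement : Rel V 0ℓ → Rel V 0ℓ
  Complement R u v = u ≢ v × ¬ R u v

  -- Disconnectedness of `R` on `us`. For `Complement R` the same statement says that `us` is a
  -- join.
  Separated : Rel V 0ℓ → List V → Set
  Separated R us = ∃ λ (σ : V → Bool) →
    (∃[ x ] ∃[ y ] (x ∈ us × y ∈ us × σ x ≢ σ y)) ×
    (∀ {u v} → u ∈ us → v ∈ us → σ u ≢ σ v → ¬ R u v)

  Subsingleton : List V → Set
  Subsingleton us = ∀ {u v} → u ∈ us → v ∈ us → u ≡ v

-- P₄ is self-complementary: the non-edges of the path a-b-c-d form the path c-a-d-b.
noP₄-complement : ∀ {R : Rel (Fin n) 0ℓ} → B.Symmetric R → B.Decidable R → NoP₄ R → NoP₄ (Complement R)
noP₄-complement {R = R} R-sym R? noP₄ {a} {b} {c} {d} ab@(_ , ¬ab) bc cd@(_ , ¬cd) ¬ac ¬bd ¬ad =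
  noP₄ {c} {a} {d} {b} (R-sym (R∌ ¬ac λ { refl → ¬ad cd })) (R∌ ¬ad λ { refl → ¬ac (Complement-sym cd) })
    (R-sym (R∌ ¬bd λ { refl → ¬ad ab })) ¬cd ¬ab (proj₂ bc ∘ R-sym)
  where
  R∌ : ∀ {u v} → ¬ Complement R u v → u ≢ v → R u v
  R∌ ¬uv u≢v = decidable-stable (R? _ _) (λ ¬Ruv → ¬uv (u≢v , ¬Ruv))
  Complement-sym : B.Symmetric (Complement R)
  Complement-sym (u≢v , ¬uv) = u≢v ∘ sym , ¬uv ∘ R-sym

module _ {n : ℕ} where

  open import Data.List.Membership.DecPropositional (_≟ᶠ_ {n}) using (_∈?_)

  module Insert {R : Rel (Fin n) 0ℓ} (R-sym : B.Symmetric R) (R? : B.Decidable R) (noP₄ : NoP₄ R)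
                {v : Fin n} {us : List (Fin n)} (v∉us : v ∉ us) where

    -- If some edge x-y inside a part has `v` adjacent to x only, then a neighbour z of `v` in the
    -- other part would give the path y-x-v-z, so `v` can be put with x. If there is no such edge,
    -- the neighbourhood of `v` is closed under adjacency. Then either `v` sees everything and is
    -- one side of a join, or `v` with its neighbours is separated from the rest.
    separated-∷ : Separated R us → Separated R (v ∷ us) ⊎ Separated (Complement R) (v ∷ us)
    separated-∷ (σ , (x₀ , y₀ , x₀∈ , y₀∈ , σx₀≢σy₀) , sep)
      with any? (λ x → any? λ y → (x ∈? us) ×-dec (y ∈? us) ×-dec (σ x ≟ᵇ σ y) ×-dec R? v x ×-dec ¬? (R? v y) ×-dec R? x y)
    ... | yes (x , y , x∈ , y∈ , σx≡σy , vx , ¬vy , xy) = inj₁ (σ′ , across , sep′)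
      where
      other : ∀ {z} → z ∈ us → σ z ≢ σ x → ¬ R v z
      other z∈ σz≢ vz = noP₄ (R-sym xy) (R-sym vx) vz (¬vy ∘ R-sym) (sep x∈ z∈ (≢-sym σz≢))
        (sep y∈ z∈ λ σy≡ → σz≢ (sym (trans σx≡σy σy≡)))
      σ′ : Fin n → Bool
      σ′ w with w ≟ᶠ v
      ... | yes _ = σ x
      ... | no  _ = σ w
      σ′-old : ∀ {w} → w ∈ us → σ′ w ≡ σ w
      σ′-old {w} w∈ with w ≟ᶠ v
      ... | yes refl = ⊥-elim (v∉us w∈)
      ... | no  _    = refl
      σ′-new : σ′ v ≡ σ x
      σ′-new with v ≟ᶠ v
      ... | yes _  = refl
      ... | no v≢v = ⊥-elim (v≢v refl)
      across : ∃[ x ] ∃[ y ] (x ∈ v ∷ us × y ∈ v ∷ us × σ′ x ≢ σ′ y)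
      across = x₀ , y₀ , there x₀∈ , there y₀∈ ,
        λ e → σx₀≢σy₀ (trans (sym (σ′-old x₀∈)) (trans e (σ′-old y₀∈)))
      sep′ : ∀ {a b} → a ∈ v ∷ us → b ∈ v ∷ us → σ′ a ≢ σ′ b → ¬ R a b
      sep′ (here refl) (here refl) σ≢ = ⊥-elim (σ≢ refl)
      sep′ (here refl) (there b∈)  σ≢ = other b∈ λ e → σ≢ (trans σ′-new (trans (sym e) (sym (σ′-old b∈))))
      sep′ (there a∈)  (here refl) σ≢ = other a∈ (λ e → σ≢ (trans (σ′-old a∈) (trans e (sym σ′-new)))) ∘ R-sym
      sep′ (there a∈)  (there b∈)  σ≢ = sep a∈ b∈ λ e → σ≢ (trans (σ′-old a∈) (trans e (sym (σ′-old b∈))))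
    ... | no ¬xy with any? (λ m → (m ∈? us) ×-dec ¬? (R? v m))
    ...   | no ¬m = inj₂ (σ′ , (v , x₀ , here refl , there x₀∈ , across) , sep′)
      where
      σ′ : Fin n → Bool
      σ′ w = does (w ≟ᶠ v)
      across : σ′ v ≢ σ′ x₀
      across rewrite dec-true (v ≟ᶠ v) refl | dec-false (x₀ ≟ᶠ v) (λ { refl → v∉us x₀∈ }) = λ ()
      joined : ∀ {w} → w ∈ us → R v w
      joined {w} w∈ = decidable-stable (R? v w) λ ¬vw → ¬m (w , w∈ , ¬vw)
      σ′-old : ∀ {w} → w ∈ us → σ′ w ≡ false
      σ′-old {w} w∈ = dec-false (w ≟ᶠ v) λ { refl → v∉us w∈ }
      sep′ : ∀ {a b} → a ∈ v ∷ us → b ∈ v ∷ us → σ′ a ≢ σ′ b → ¬ Complement R a b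
      sep′ (here refl) (here refl) σ≢ _       = σ≢ refl
      sep′ (here refl) (there b∈)  σ≢ (_ , ¬ab) = ¬ab (joined b∈)
      sep′ (there a∈)  (here refl) σ≢ (_ , ¬ab) = ¬ab (R-sym (joined a∈))
      sep′ (there a∈)  (there b∈)  σ≢ _       = σ≢ (trans (σ′-old a∈) (sym (σ′-old b∈)))
    ...   | yes (m , m∈ , ¬vm) = inj₁ (σ′ , (v , m , here refl , there m∈ , across) , sep′)
      where
      near? : Decidable (λ w → w ≡ v ⊎ R v w)
      near? w = (w ≟ᶠ v) ⊎-dec R? v w
      σ′ : Fin n → Bool
      σ′ w = does (near? w)
      across : σ′ v ≢ σ′ m
      across rewrite dec-true (near? v) (inj₁ refl)
                   | dec-false (near? m) [ (λ { refl → v∉us m∈ }) , ¬vm ] = λ ()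
      apart : ∀ {x y} → x ∈ us → y ∈ us → R v x → ¬ R v y → ¬ R x y
      apart {x} {y} x∈ y∈ vx ¬vy xy with σ x ≟ᵇ σ y
      ... | yes σ≡ = ¬xy (x , y , x∈ , y∈ , σ≡ , vx , ¬vy , xy)
      ... | no  σ≢ = sep x∈ y∈ σ≢ xy
      close : ∀ {w} → R v w → σ′ w ≡ true
      close vw = dec-true (near? _) (inj₂ vw)
      far : ∀ {w} → w ∈ us → ¬ R v w → σ′ w ≡ false
      far w∈ ¬vw = dec-false (near? _) [ (λ { refl → v∉us w∈ }) , ¬vw ]
      sep′ : ∀ {a b} → a ∈ v ∷ us → b ∈ v ∷ us → σ′ a ≢ σ′ b → ¬ R a b
      sep′ (here refl) (here refl) σ≢ _  = σ≢ refl
      sep′ (here refl) (there b∈)  σ≢ ab = σ≢ (trans (dec-true (near? v) (inj₁ refl)) (sym (close ab)))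
      sep′ (there a∈)  (here refl) σ≢ ab =
        σ≢ (trans (close (R-sym ab)) (sym (dec-true (near? v) (inj₁ refl))))
      sep′ {a} {b} (there a∈) (there b∈) σ≢ ab = cases (R? v a) (R? v b)
        where
        cases : Dec (R v a) → Dec (R v b) → ⊥
        cases (yes va) (yes vb) = σ≢ (trans (close va) (sym (close vb)))
        cases (yes va) (no ¬vb) = apart a∈ b∈ va ¬vb ab
        cases (no ¬va) (yes vb) = apart b∈ a∈ vb ¬va (R-sym ab)
        cases (no ¬va) (no ¬vb) = σ≢ (trans (far a∈ ¬va) (sym (far b∈ ¬vb)))

  separated-∷-∈ : ∀ {R : Rel (Fin n) 0ℓ} {v us} → v ∈ us → Separated R us → Separated R (v ∷ us)
  separated-∷-∈ v∈ (σ , (x , y , x∈ , y∈ , σ≢) , sep) =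
    σ , (x , y , there x∈ , there y∈ , σ≢) , λ a∈ b∈ → sep (drop a∈) (drop b∈)
    where
    drop : ∀ {a} → a ∈ _ ∷ _ → a ∈ _
    drop (here refl) = v∈
    drop (there a∈)  = a∈

  module Decompose {R : Rel (Fin n) 0ℓ} (R-sym : B.Symmetric R) (R? : B.Decidable R) (noP₄ : NoP₄ R) where

    private
      R̄-sym : B.Symmetric (Complement R)
      R̄-sym (u≢v , ¬uv) = u≢v ∘ sym , ¬uv ∘ R-sym
      R̄? : B.Decidable (Complement R)
      R̄? u v = ¬? (u ≟ᶠ v) ×-dec ¬? (R? u v)

    -- Seinsche's theorem.
    decompose : ∀ us → Subsingleton us ⊎ Separated R us ⊎ Separated (Complement R) us
    decompose [] = inj₁ λ ()
    decompose (v ∷ us) with v ∈? us | decompose us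
    ... | yes v∈ | inj₁ one = inj₁ λ a∈ b∈ → one (drop a∈) (drop b∈)
      where
      drop : ∀ {a} → a ∈ _ ∷ _ → a ∈ us
      drop (here refl) = v∈
      drop (there a∈)  = a∈
    ... | yes v∈ | inj₂ (inj₁ s) = inj₂ (inj₁ (separated-∷-∈ v∈ s))
    ... | yes v∈ | inj₂ (inj₂ s) = inj₂ (inj₂ (separated-∷-∈ v∈ s))
    ... | no v∉ | inj₂ (inj₁ s) = inj₂ (Insert.separated-∷ R-sym R? noP₄ v∉ s)
    -- For a join the insertion is carried out in the complement; a separation of the double
    -- complement is turned back into one of `R`.
    ... | no v∉ | inj₂ (inj₂ s) with Insert.separated-∷ R̄-sym R̄? (noP₄-complement R-sym R? noP₄) v∉ s
    ...   | inj₁ s′ = inj₂ (inj₂ s′)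
    ...   | inj₂ (σ , across , sep) = inj₂ (inj₁ (σ , across , λ u∈ v∈ σ≢ uv →
              sep u∈ v∈ σ≢ ((λ { refl → σ≢ refl }) , λ { (_ , ¬uv) → ¬uv uv })))
    decompose (v ∷ [])     | no v∉ | inj₁ _ = inj₁ λ { (here refl) (here refl) → refl }
    decompose (v ∷ w ∷ us) | no v∉ | inj₁ one with R? v w
    ... | yes vw = inj₂ (inj₂ (σ , (v , w , here refl , there (here refl) , across) , sep))
      where
      σ : Fin n → Bool
      σ u = does (u ≟ᶠ v)
      across : σ v ≢ σ w
      across rewrite dec-true (v ≟ᶠ v) refl | dec-false (w ≟ᶠ v) (λ { refl → v∉ (here refl) }) = λ ()
      sep : ∀ {a b} → a ∈ v ∷ w ∷ us → b ∈ v ∷ w ∷ us → σ a ≢ σ b → ¬ Complement R a b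
      sep (here refl) (here refl) σ≢ _ = σ≢ refl
      sep (here refl) (there b∈) σ≢ (_ , ¬ab) with refl ← one b∈ (here refl) = ¬ab vw
      sep (there a∈) (here refl) σ≢ (_ , ¬ab) with refl ← one a∈ (here refl) = ¬ab (R-sym vw)
      sep (there a∈) (there b∈) σ≢ _ = σ≢ (cong σ (one a∈ b∈))
    ... | no ¬vw = inj₂ (inj₁ (σ , (v , w , here refl , there (here refl) , across) , sep))
      where
      σ : Fin n → Bool
      σ u = does (u ≟ᶠ v)
      across : σ v ≢ σ w
      across rewrite dec-true (v ≟ᶠ v) refl | dec-false (w ≟ᶠ v) (λ { refl → v∉ (here refl) }) = λ ()
      sep : ∀ {a b} → a ∈ v ∷ w ∷ us → b ∈ v ∷ w ∷ us → σ a ≢ σ b → ¬ R a b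
      sep (here refl) (here refl) σ≢ _ = σ≢ refl
      sep (here refl) (there b∈) σ≢ ab with refl ← one b∈ (here refl) = ¬vw ab
      sep (there a∈) (here refl) σ≢ ab with refl ← one a∈ (here refl) = ¬vw (R-sym ab)
      sep (there a∈) (there b∈) σ≢ _ = σ≢ (cong σ (one a∈ b∈))

ColouringOn : Graph (Fin n) → Pred (Fin n) 0ℓ → ℕ → (Fin n → ℕ) → Set
ColouringOn G P q c = (∀ {v} → P v → c v < q) × (∀ {u v} → P u → P v → _~_ G u v → c u ≢ c v)

colouringOn-⊆ : ∀ {G : Graph (Fin n)} {P Q q c} → (∀ {v} → P v → Q v) → ColouringOn G Q q c → ColouringOn G P q c
colouringOn-⊆ P⊆Q (bound , proper) = bound ∘ P⊆Q , λ Pu Pv → proper (P⊆Q Pu) (P⊆Q Pv)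

Joined : Graph (Fin n) → Pred (Fin n) 0ℓ → (Fin n → Bool) → Set
Joined G P σ = ∀ {u v} → P u → P v → σ u ≢ σ v → _~_ G u v

-- In a join the two sides use disjoint sets of colours; renumbering each set by
-- rank splits the number of colours.
split-colours : ∀ {G : Graph (Fin n)} {P} (P? : Decidable P) σ {q c} → Joined G P σ → ColouringOn G P q c →
  ∃ λ (qs : Bool → ℕ) → qs true + qs false ≡ q × ∃ λ (cs : Bool → Fin n → ℕ) →
    ∀ b → ColouringOn G (λ v → P v × σ v ≡ b) (qs b) (cs b)
split-colours {G = G} {P} P? σ {q} {c} joined (bound , proper) =
  (λ b → rank (side b) q) , rank-complement D q , (λ b → rank (side b) ∘ c) ,
  λ b → (λ { (Pv , refl) → rank-< (side b) (side-true Pv) (bound Pv) }) ,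
        λ { (Pu , refl) (Pv , σv) uv eq →
            proper Pu Pv uv (rank-injective (side b) (side-true Pu) (subst (λ b → side b (c _) ≡ true) σv (side-true Pv)) eq) }
  where
  -- Colours that occur on neither side are assigned to `false`, so that the two counts add up to
  -- exactly `q`.
  used? : ∀ i → Dec (∃[ v ] (P v × σ v ≡ true × c v ≡ i))
  used? i = any? λ v → P? v ×-dec (σ v ≟ᵇ true) ×-dec (c v ≟ i)
  D : ℕ → Bool
  D i = does (used? i)
  side : Bool → ℕ → Bool
  side true  = D
  side false = not ∘ D
  side-true : ∀ {v} → P v → side (σ v) (c v) ≡ true
  side-true {v} Pv with σ v in σv
  ... | true  = dec-true (used? (c v)) (v , Pv , σv , refl)
  ... | false = cong not (dec-false (used? (c v)) λ { (u , Pu , σu , cu≡cv) →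
      proper Pu Pv (joined Pu Pv λ e → contradiction (trans (sym σu) (trans e σv)) λ ()) cu≡cv })

part : (Fin n → Bool) → Bool → List (Fin n) → List (Fin n)
part σ b = filter (λ v → σ v ≟ᵇ b)

module _ (σ : Fin n → Bool) where

  ∈-part⁻ : ∀ b us {v} → v ∈ part σ b us → v ∈ us × σ v ≡ b
  ∈-part⁻ b us = ∈-filter⁻ (λ v → σ v ≟ᵇ b) {xs = us}

  ∈-part⁺ : ∀ {us v} → v ∈ us → ∀ {b} → σ v ≡ b → v ∈ part σ b us
  ∈-part⁺ v∈ {b} = ∈-filter⁺ (λ v → σ v ≟ᵇ b) v∈

  part-shorter : ∀ b {us x y} → x ∈ us → y ∈ us → σ x ≢ σ y → length (part σ b us) < length us
  part-shorter b {us} {x} x∈ y∈ σ≢ with σ x ≟ᵇ b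
  ... | yes σx = filter-notAll _ us (lose y∈ λ σy → σ≢ (trans σx (sym σy)))
  ... | no ¬σx = filter-notAll _ us (lose x∈ ¬σx)

  length-part : ∀ us → length (part σ true us) + length (part σ false us) ≡ length us
  length-part [] = refl
  length-part (u ∷ us) with σ u
  ... | true  = cong suc (length-part us)
  ... | false = trans (+-suc _ _) (cong suc (length-part us))

module P₄Free {n : ℕ} (G : Graph (Fin n)) (noP₄ : NoP₄ (_~_ G)) where

  open import Data.List.Membership.DecPropositional (_≟ᶠ_ {n}) using (_∈?_)

  Saved : List (Fin n) → ℕ → List (Fin n) → Set
  Saved us p xs = ∃ λ (c : Fin n → ℕ) → ColouringOn G (_∈ us) (suc p) c ×
    ∃[ ys ] (length ys ≤ length xs × (∀ {v} → v ∈ us → c v ≡ 0 → v ∈ ys))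

  -- Class 0 shrinks to the size of `xs`. In a disjoint union the classes of the parts are
  -- collected. In a join the numbers of colours add up to `suc p` with `xs` and to `p` without it,
  -- so some side needs fewer colours after the deletion. The induction is applied to that side, and
  -- the other side gets its colours shifted past them, hence contributes nothing to class 0.
  save : ∀ m us → length us ≤ m → ∀ p xs {c d} → ColouringOn G (_∈ us) (suc p) c →
         ColouringOn G (λ v → v ∈ us × v ∉ xs) p d → Saved us p xs
  save zero [] _ p xs _ _ = (λ _ → 0) , ((λ ()) , λ ()) , [] , z≤n , λ ()
  save (suc m) us ≤m p xs {c} {d} col del with Decompose.decompose (~-sym G) (_~?_ G) noP₄ us
  ... | inj₁ one = single p del
    where
    single : ∀ p → ColouringOn G (λ v → v ∈ us × v ∉ xs) p d → Saved us p xs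
    -- No colour is left after the deletion, so the only vertex must lie in `xs`.
    single zero del =
      (λ _ → 0) , ((λ _ → s≤s z≤n) , λ u∈ v∈ uv _ → ~-irrefl G (one u∈ v∈) uv) ,
      xs , ≤-refl , λ {v} v∈ _ → decidable-stable (v ∈? xs) λ v∉ → contradiction (proj₁ del (v∈ , v∉)) λ ()
    single (suc p) _ =
      (λ _ → 1) , ((λ _ → s≤s (s≤s z≤n)) , λ u∈ v∈ uv _ → ~-irrefl G (one u∈ v∈) uv) ,
      [] , z≤n , λ _ ()
  ... | inj₂ (inj₁ (σ , (x , y , x∈ , y∈ , σ≢) , sep)) = assemble λ b → save m (part σ b us) (shorter b) p (part σ b xs)
      (colouringOn-⊆ {G = G} (proj₁ ∘ ∈-part⁻ σ b us) col)
      (colouringOn-⊆ {G = G} (λ { (v∈ , v∉) → proj₁ (∈-part⁻ σ b us v∈) , λ v∈xs → v∉ (∈-part⁺ σ v∈xs (proj₂ (∈-part⁻ σ b us v∈))) }) del)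
    where
    shorter : ∀ b → length (part σ b us) ≤ m
    shorter b = s≤s⁻¹ (≤-trans (part-shorter σ b x∈ y∈ σ≢) ≤m)
    assemble : (∀ b → Saved (part σ b us) p (part σ b xs)) → Saved us p xs
    assemble saved =
      (λ v → C (σ v) v) ,
      ((λ {v} v∈ → proj₁ (C-col (σ v)) (∈-part⁺ σ v∈ refl)) ,
       λ {u} {v} u∈ v∈ uv eq → proper u∈ v∈ uv eq) ,
      proj₁ (cover true) ++ proj₁ (cover false) ,
      subst (_≤ _) (sym (length-++ (proj₁ (cover true))))
        (≤-trans (+-mono-≤ (proj₁ (proj₂ (cover true))) (proj₁ (proj₂ (cover false)))) (≤-reflexive (length-part σ xs))) ,
      λ {v} v∈ Cv → merge (σ v) (proj₂ (proj₂ (cover (σ v))) (∈-part⁺ σ v∈ refl) Cv)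
      where
      C : Bool → Fin n → ℕ
      C b = proj₁ (saved b)
      C-col : ∀ b → ColouringOn G (_∈ part σ b us) (suc p) (C b)
      C-col b = proj₁ (proj₂ (saved b))
      cover : ∀ b → ∃[ ys ] (length ys ≤ length (part σ b xs) × (∀ {v} → v ∈ part σ b us → C b v ≡ 0 → v ∈ ys))
      cover b = proj₂ (proj₂ (saved b))
      proper : ∀ {u v} → u ∈ us → v ∈ us → _~_ G u v → C (σ u) u ≢ C (σ v) v
      proper {u} {v} u∈ v∈ uv eq with σ u ≟ᵇ σ v
      ... | yes σ≡ = proj₂ (C-col (σ u)) (∈-part⁺ σ u∈ refl) (∈-part⁺ σ v∈ (sym σ≡)) uv
                       (trans eq (cong (λ b → C b v) (sym σ≡)))
      ... | no σ≢  = sep u∈ v∈ σ≢ uv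
      merge : ∀ b {v} → v ∈ proj₁ (cover b) → v ∈ proj₁ (cover true) ++ proj₁ (cover false)
      merge true  = ∈-++⁺ˡ
      merge false = ∈-++⁺ʳ _
  ... | inj₂ (inj₂ (σ , (x , y , x∈ , y∈ , σ≢) , sep)) = assemble
      (split-colours {G = G} (_∈? us) σ joined col)
      (split-colours {G = G} (λ v → (v ∈? us) ×-dec ¬? (v ∈? xs)) σ (λ u∈ v∈ → joined (proj₁ u∈) (proj₁ v∈)) del)
    where
    joined : Joined G (_∈ us) σ
    joined u∈ v∈ σ≢ = decidable-stable (_~?_ G _ _) λ ¬uv → sep u∈ v∈ σ≢ ((λ { refl → σ≢ refl }) , ¬uv)
    shorter : ∀ b → length (part σ b us) ≤ m
    shorter b = s≤s⁻¹ (≤-trans (part-shorter σ b x∈ y∈ σ≢) ≤m)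
    Split : Pred (Fin n) 0ℓ → ℕ → Set
    Split P q = ∃ λ (qs : Bool → ℕ) → qs true + qs false ≡ q × ∃ λ (cs : Bool → Fin n → ℕ) →
                ∀ b → ColouringOn G (λ v → P v × σ v ≡ b) (qs b) (cs b)
    assemble : Split (_∈ us) (suc p) → Split (λ v → v ∈ us × v ∉ xs) p → Saved us p xs
    assemble (qs , Σqs , cs , cs-col) (rs , Σrs , ds , ds-col) = pick (<-≤-connex (rs true) (qs true))
      where
      saveSide : ∀ b → rs b < qs b → qs b + qs (not b) ≡ suc p → Saved us p xs
      saveSide b r<q Σq with qs b in qb
      saveSide b (s≤s r≤q′) refl | suc q′ with save m (part σ b us) (shorter b) q′ (part σ b xs)
          (colouringOn-⊆ {G = G} (∈-part⁻ σ b us) (subst (λ q → ColouringOn G _ q (cs b)) qb (cs-col b)))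
          (colouringOn-⊆ {G = G} (λ { (v∈ , v∉) → (proj₁ (∈-part⁻ σ b us v∈) , λ v∈xs → v∉ (∈-part⁺ σ v∈xs (proj₂ (∈-part⁻ σ b us v∈)))) , proj₂ (∈-part⁻ σ b us v∈) })
            (≤-trans′ (ds-col b)))
        where
        ≤-trans′ : ∀ {P} → ColouringOn G P (rs b) (ds b) → ColouringOn G P q′ (ds b)
        ≤-trans′ (bound , proper) = (λ Pv → ≤-trans (bound Pv) r≤q′) , proper
      ... | C , (C< , C≢) , ys , ys≤ , cov =
        E , (E< , E≢) , ys , ≤-trans ys≤ (length-filter _ xs) , E-cov
        where
        C′ : Fin n → ℕ
        C′ v = suc q′ + cs (not b) v
        E : Fin n → ℕ
        E v = if does (σ v ≟ᵇ b) then C v else C′ v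
        here∈ : ∀ {v} → v ∈ us → σ v ≡ b → v ∈ part σ b us
        here∈ v∈ = ∈-part⁺ σ v∈
        E< : ∀ {v} → v ∈ us → E v < suc q′ + qs (not b)
        E< {v} v∈ with σ v ≟ᵇ b
        ... | yes σv = ≤-trans (C< (here∈ v∈ σv)) (m≤m+n (suc q′) _)
        ... | no ¬σv = +-monoʳ-< (suc q′) (proj₁ (cs-col (not b)) (v∈ , ¬-not ¬σv))
        E≢ : ∀ {u v} → u ∈ us → v ∈ us → _~_ G u v → E u ≢ E v
        E≢ {u} {v} u∈ v∈ uv eq with σ u ≟ᵇ b | σ v ≟ᵇ b
        ... | yes σu | yes σv = C≢ (here∈ u∈ σu) (here∈ v∈ σv) uv eq
        ... | yes σu | no ¬σv = <⇒≢ (≤-trans (C< (here∈ u∈ σu)) (m≤m+n (suc q′) _)) eq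
        ... | no ¬σu | yes σv = <⇒≢ (≤-trans (C< (here∈ v∈ σv)) (m≤m+n (suc q′) _)) (sym eq)
        ... | no ¬σu | no ¬σv = proj₂ (cs-col (not b)) (u∈ , ¬-not ¬σu) (v∈ , ¬-not ¬σv) uv (+-cancelˡ-≡ (suc q′) _ _ eq)
        E-cov : ∀ {v} → v ∈ us → E v ≡ 0 → v ∈ ys
        E-cov {v} v∈ eq with σ v ≟ᵇ b
        ... | yes σv = cov (here∈ v∈ σv) eq
      pick : rs true < qs true ⊎ qs true ≤ rs true → Saved us p xs
      pick (inj₁ r<q) = saveSide true r<q Σqs
      pick (inj₂ q≤r) = saveSide false
        (+-cancelˡ-< (qs true) _ _ (≤-trans (s≤s (+-monoˡ-≤ _ q≤r)) (≤-reflexive (trans (cong suc Σrs) (sym Σqs)))))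
        (trans (+-comm (qs false) (qs true)) Σqs)

p₄-free-recolourable : ∀ (G : Graph (Fin n)) → NoP₄ (_~_ G) → Colourable 3 G →
  ∀ {S} → OddCycleTransversal G S → Recolourable G ∣ S ∣
p₄-free-recolourable {n} G noP₄ (c , proper) {S} (d , d-proper) with atMost-∈ S
... | xs , xs≤ , S⊆xs with P₄Free.save G noP₄ _ (allFin n) ≤-refl 2 xs {toℕ ∘ c} {d′}
        ((λ {v} _ → toℕ<n (c v)) , λ {u} {v} _ _ uv eq → proper u v uv (toℕ-injective eq))
        ((λ {v} → d′< v) , λ {u} {v} → d′≢ u v)
  where
  -- The value 0 on `S` is a dummy: only vertices outside `xs` are looked at, and `xs` covers `S`.
  d′ : Fin n → ℕ
  d′ v with v ∈ˢ? S
  ... | yes _ = 0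
  ... | no v∉ = toℕ (d (v , v∉))
  d′< : ∀ v → v ∈ allFin n × v ∉ xs → d′ v < 2
  d′< v _ with v ∈ˢ? S
  ... | yes _ = s≤s z≤n
  ... | no v∉ = toℕ<n (d (v , v∉))
  d′≢ : ∀ u v → u ∈ allFin n × u ∉ xs → v ∈ allFin n × v ∉ xs → _~_ G u v → d′ u ≢ d′ v
  d′≢ u v (_ , u∉) (_ , v∉) uv eq with u ∈ˢ? S | v ∈ˢ? S
  ... | yes u∈ | _      = u∉ (S⊆xs u u∈)
  ... | no _   | yes v∈ = v∉ (S⊆xs v v∈)
  ... | no u∉S | no v∉S = d-proper (u , u∉S) (v , v∉S) uv (toℕ-injective eq)
... | C , (C< , C≢) , ys , ys≤ , cov =
  (λ v → fromℕ< (C< (∈-allFin v))) ,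
  (λ u v uv eq → C≢ (∈-allFin u) (∈-allFin v) uv (fromℕ<-injective _ _ _ _ eq)) ,
  zero , ys , ≤-trans ys≤ xs≤ ,
  λ v eq → cov (∈-allFin v) (trans (sym (toℕ-fromℕ< (C< (∈-allFin v)))) (cong toℕ eq))

ordered-⊴ : ∀ {k} {V : Set} {F : Graph (Fin k)} {G : Graph V} (f : Fin k → V) →
            (∀ {i j} → i <ᶠ j → f i ≢ f j × (_~_ F i j ⇔ _~_ G (f i) (f j))) → F ⊴ G
ordered-⊴ {F = F} {G} f ordered = f , inj , adj
  where
  inj : Injective _≡_ _≡_ f
  inj {i} {j} e with <ᶠ-cmp i j
  ... | B.tri< i<j _ _ = ⊥-elim (proj₁ (ordered i<j) e)
  ... | B.tri≈ _ i≡j _ = i≡j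
  ... | B.tri> _ _ j<i = ⊥-elim (proj₁ (ordered j<i) (sym e))
  adj : ∀ i j → _~_ F i j ⇔ _~_ G (f i) (f j)
  adj i j with <ᶠ-cmp i j
  ... | B.tri< i<j _ _ = proj₂ (ordered i<j)
  ... | B.tri≈ _ refl _ = mk⇔ (⊥-elim ∘ ~-irrefl F refl) (⊥-elim ∘ ~-irrefl G refl)
  ... | B.tri> _ _ j<i = mk⇔ (~-sym G ∘ Equivalence.to e ∘ ~-sym F) (~-sym F ∘ Equivalence.from e ∘ ~-sym G)
    where e = proj₂ (ordered j<i)

path₄-⊴ : ∀ {V : Set} {G : Graph V} {a b c d} → _~_ G a b → _~_ G b c → _~_ G c d →
          ¬ _~_ G a c → ¬ _~_ G b d → ¬ _~_ G a d → path 4 ⊴ G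
path₄-⊴ {G = G} {a} {b} {c} {d} ab bc cd ¬ac ¬bd ¬ad = ordered-⊴ {F = path 4} {G} (lookup (a ∷ b ∷ c ∷ d ∷ [])) (ordered _ _)
  where
  edge : ∀ {u v} {P : Set} → _~_ G u v → P → u ≢ v × (P ⇔ _~_ G u v)
  edge uv p = (λ e → ~-irrefl G e uv) , mk⇔ (λ _ → uv) (λ _ → p)
  ordered : ∀ i j → i <ᶠ j → lookup (a ∷ b ∷ c ∷ d ∷ []) i ≢ lookup (a ∷ b ∷ c ∷ d ∷ []) j ×
            (_~_ (path 4) i j ⇔ _~_ G (lookup (a ∷ b ∷ c ∷ d ∷ []) i) (lookup (a ∷ b ∷ c ∷ d ∷ []) j))
  ordered 0F 1F _ = edge ab (inj₁ refl)
  ordered 1F 2F _ = edge bc (inj₁ refl)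
  ordered 2F 3F _ = edge cd (inj₁ refl)
  ordered 0F 2F _ = (λ { refl → ¬ad cd }) , mk⇔ (λ { (inj₁ ()) ; (inj₂ ()) }) (⊥-elim ∘ ¬ac)
  ordered 1F 3F _ = (λ { refl → ¬ad ab }) , mk⇔ (λ { (inj₁ ()) ; (inj₂ ()) }) (⊥-elim ∘ ¬bd)
  ordered 0F 3F _ = (λ { refl → ¬ac (~-sym G cd) }) , mk⇔ (λ { (inj₁ ()) ; (inj₂ ()) }) (⊥-elim ∘ ¬ad)
  ordered 1F 1F (s≤s ())
  ordered 2F 1F (s≤s ())
  ordered 2F 2F (s≤s (s≤s ()))
  ordered 3F 1F (s≤s ())
  ordered 3F 2F (s≤s (s≤s ()))
  ordered 3F 3F (s≤s (s≤s (s≤s ())))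

ioctBounded-P₄ : ∀ {H : Graph (Fin n)} → H ⊴ path 4 → IoctBounded (FreeThreeColourable H)
ioctBounded-P₄ {H = H} H⊴P₄ = id , λ G (H-free , col₃) ((S , oct , ∣S∣≡k) , _) ioct →
  recolourable⇒ioct≤ G ioct (subst (Recolourable G) ∣S∣≡k
    (p₄-free-recolourable G (λ ab bc cd ¬ac ¬bd ¬ad →
      H-free (⊴-trans {F = H} {path 4} {G} H⊴P₄ (path₄-⊴ {G = G} ab bc cd ¬ac ¬bd ¬ad))) col₃ oct))

-- (K₁,₃ + sP₁)-free graphs

-- Being heavy becomes decidable, although it quantifies over functions.
many? : ∀ {n} {P : Pred (Fin n) 0ℓ} → Decidable P → ∀ m → Dec (Many (suc m) P)
many? P? m with atMost⊎many P? m
... | inj₁ few  = no (¬atMost∧many few)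
... | inj₂ many = yes many

¬many⇒atMost : ∀ {n} {P : Pred (Fin n) 0ℓ} → Decidable P → ∀ {m} → ¬ Many (suc m) P → AtMost m P
¬many⇒atMost P? {m} ¬many = [ id , ⊥-elim ∘ ¬many ] (atMost⊎many P? m)

module _ {n : ℕ} (G : Graph (Fin n)) where

  claw+sP₁ : ∀ {s} {I : Pred (Fin n) 0ℓ} → (∀ {u v} → I u → I v → ¬ _~_ G u v) → ∀ {u} →
             Many 3 (λ v → I v × _~_ G u v) → Many s (λ v → I v × ¬ _~_ G u v) →
             star 3 +ᴳ copies s (path 1) ⊴ G
  claw+sP₁ {s} {I} indep {u} (f , f-inj , f∈) (g , g-inj , g∈) = h , inj , λ x y → mk⇔ (to x y) (from x y)
    where
    h : Fin 4 ⊎ Fin s × Fin 1 → Fin n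
    h (inj₁ zero)    = u
    h (inj₁ (suc i)) = f i
    h (inj₂ (j , _)) = g j
    u∉I : ¬ I u
    u∉I Iu = indep Iu (proj₁ (f∈ zero)) (proj₂ (f∈ zero))
    inj : Injective _≡_ _≡_ h
    inj {inj₁ zero}    {inj₁ zero}    _ = refl
    inj {inj₁ zero}    {inj₁ (suc j)} e = ⊥-elim (~-irrefl G e (proj₂ (f∈ j)))
    inj {inj₁ zero}    {inj₂ (j , _)} e = ⊥-elim (u∉I (subst I (sym e) (proj₁ (g∈ j))))
    inj {inj₁ (suc i)} {inj₁ zero}    e = ⊥-elim (~-irrefl G (sym e) (proj₂ (f∈ i)))
    inj {inj₁ (suc i)} {inj₁ (suc j)} e = cong (inj₁ ∘ suc) (f-inj e)
    inj {inj₁ (suc i)} {inj₂ (j , _)} e = ⊥-elim (proj₂ (g∈ j) (subst (_~_ G u) e (proj₂ (f∈ i))))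
    inj {inj₂ (i , _)} {inj₁ zero}    e = ⊥-elim (u∉I (subst I e (proj₁ (g∈ i))))
    inj {inj₂ (i , _)} {inj₁ (suc j)} e = ⊥-elim (proj₂ (g∈ i) (subst (_~_ G u) (sym e) (proj₂ (f∈ j))))
    inj {inj₂ (i , zero)} {inj₂ (j , zero)} e = cong (λ k → inj₂ (k , zero)) (g-inj e)
    to : ∀ x y → _~_ (star 3 +ᴳ copies s (path 1)) x y → _~_ G (h x) (h y)
    to _ _ (⊎.inj₁ (centre-leaf i)) = proj₂ (f∈ i)
    to _ _ (⊎.inj₁ (leaf-centre i)) = ~-sym G (proj₂ (f∈ i))
    to (inj₂ (i , zero)) (inj₂ (j , zero)) (⊎.inj₂ (_ , inj₁ ()))
    to (inj₂ (i , zero)) (inj₂ (j , zero)) (⊎.inj₂ (_ , inj₂ ()))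
    from : ∀ x y → _~_ G (h x) (h y) → _~_ (star 3 +ᴳ copies s (path 1)) x y
    from (inj₁ zero)    (inj₁ zero)    e = ⊥-elim (~-irrefl G refl e)
    from (inj₁ zero)    (inj₁ (suc j)) e = ⊎.inj₁ (centre-leaf j)
    from (inj₁ zero)    (inj₂ (j , _)) e = ⊥-elim (proj₂ (g∈ j) e)
    from (inj₁ (suc i)) (inj₁ zero)    e = ⊎.inj₁ (leaf-centre i)
    from (inj₁ (suc i)) (inj₁ (suc j)) e = ⊥-elim (indep (proj₁ (f∈ i)) (proj₁ (f∈ j)) e)
    from (inj₁ (suc i)) (inj₂ (j , _)) e = ⊥-elim (indep (proj₁ (f∈ i)) (proj₁ (g∈ j)) e)
    from (inj₂ (i , _)) (inj₁ zero)    e = ⊥-elim (proj₂ (g∈ i) (~-sym G e))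
    from (inj₂ (i , _)) (inj₁ (suc j)) e = ⊥-elim (indep (proj₁ (g∈ i)) (proj₁ (f∈ j)) e)
    from (inj₂ (i , _)) (inj₂ (j , _)) e = ⊥-elim (indep (proj₁ (g∈ i)) (proj₁ (g∈ j)) e)

allᵇ? : ∀ {P : Pred Bool 0ℓ} → Decidable P → Dec (∀ b → P b)
allᵇ? P? = map′ (λ { (pt , pf) true → pt ; (pt , pf) false → pf }) (λ p → p true , p false) (P? true ×-dec P? false)

-- F b i says that colour i is not available on side b.  Either some colour is
-- unavailable on both sides, or there are a main colour α b for each side and a
-- transition colour γ.
Choice : (Bool → Fin 3 → Bool) → Set
Choice F =
  (∃[ i ] (∀ b → F b i ≡ true)) ⊎
  (∃[ γ ] ∃[ αt ] ∃[ αf ] (αt ≢ αf × αt ≢ γ × αf ≢ γ ×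
    (∀ i → F true  i ≡ false → F true  αt ≡ false × (F true  γ ≡ false ⊎ F true  αf ≡ true)) ×
    (∀ i → F false i ≡ false → F false αf ≡ false × (F false γ ≡ false ⊎ F false αt ≡ true))))

choice? : ∀ F → Dec (Choice F)
choice? F =
  any? (λ i → allᵇ? λ b → F b i ≟ᵇ true) ⊎-dec
  any? (λ γ → any? λ αt → any? λ αf → ¬? (αt ≟ᶠ αf) ×-dec ¬? (αt ≟ᶠ γ) ×-dec ¬? (αf ≟ᶠ γ) ×-dec
    all? (λ i → (F true  i ≟ᵇ false) →-dec ((F true  αt ≟ᵇ false) ×-dec ((F true  γ ≟ᵇ false) ⊎-dec (F true  αf ≟ᵇ true)))) ×-dec
    all? (λ i → (F false i ≟ᵇ false) →-dec ((F false αf ≟ᵇ false) ×-dec ((F false γ ≟ᵇ false) ⊎-dec (F false αt ≟ᵇ true)))))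

table : (x₀ x₁ x₂ y₀ y₁ y₂ : Bool) → Bool → Fin 3 → Bool
table x₀ x₁ x₂ y₀ y₁ y₂ true  zero             = x₀
table x₀ x₁ x₂ y₀ y₁ y₂ true  (suc zero)       = x₁
table x₀ x₁ x₂ y₀ y₁ y₂ true  (suc (suc zero)) = x₂
table x₀ x₁ x₂ y₀ y₁ y₂ false zero             = y₀
table x₀ x₁ x₂ y₀ y₁ y₂ false (suc zero)       = y₁
table x₀ x₁ x₂ y₀ y₁ y₂ false (suc (suc zero)) = y₂

-- Evaluation of all 64 tables. Passing through `table` replaces an arbitrary function by six
-- Booleans that can be enumerated; `choice` returns to the function pointwise.
choice-table : ∀ x₀ x₁ x₂ y₀ y₁ y₂ → Choice (table x₀ x₁ x₂ y₀ y₁ y₂)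
choice-table = from-yes
  (allᵇ? λ x₀ → allᵇ? λ x₁ → allᵇ? λ x₂ → allᵇ? λ y₀ → allᵇ? λ y₁ → allᵇ? λ y₂ → choice? (table x₀ x₁ x₂ y₀ y₁ y₂))

choice-resp : ∀ {F F′} → (∀ b i → F b i ≡ F′ b i) → Choice F → Choice F′
choice-resp F≗ (inj₁ (i , Fi)) = inj₁ (i , λ b → trans (sym (F≗ b i)) (Fi b))
choice-resp {F} {F′} F≗ (inj₂ (γ , αt , αf , t≢f , t≢γ , f≢γ , okt , okf)) =
  inj₂ (γ , αt , αf , t≢f , t≢γ , f≢γ ,
    (λ i Fi → transport (okt i (trans (F≗ true i) Fi))) ,
    (λ i Fi → transport (okf i (trans (F≗ false i) Fi))))
  where
  transport : ∀ {b x y z} → F b x ≡ false × (F b y ≡ false ⊎ F b z ≡ true) → F′ b x ≡ false × (F′ b y ≡ false ⊎ F′ b z ≡ true)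
  transport (e , inj₁ e′) = trans (sym (F≗ _ _)) e , inj₁ (trans (sym (F≗ _ _)) e′)
  transport (e , inj₂ e′) = trans (sym (F≗ _ _)) e , inj₂ (trans (sym (F≗ _ _)) e′)

choice : ∀ F → Choice F
choice F = choice-resp table≗F
  (choice-table (F true zero) (F true (suc zero)) (F true (suc (suc zero)))
                (F false zero) (F false (suc zero)) (F false (suc (suc zero))))
  where
  table≗F : ∀ b i → table (F true zero) (F true (suc zero)) (F true (suc (suc zero)))
                          (F false zero) (F false (suc zero)) (F false (suc (suc zero))) b i ≡ F b i
  table≗F true  zero             = refl
  table≗F true  (suc zero)       = refl
  table≗F true  (suc (suc zero)) = refl
  table≗F false zero             = refl
  table≗F false (suc zero)       = refl
  table≗F false (suc (suc zero)) = refl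

four-colours : ∀ (w x y z : Fin 3) → w ≢ x → w ≢ y → w ≢ z → x ≢ y → x ≢ z → y ≢ z → ⊥
four-colours = from-yes (all? {n = 3} λ w → all? {n = 3} λ x → all? {n = 3} λ y → all? {n = 3} λ z →
  ¬? (w ≟ᶠ x) →-dec (¬? (w ≟ᶠ y) →-dec (¬? (w ≟ᶠ z) →-dec (¬? (x ≟ᶠ y) →-dec (¬? (x ≟ᶠ z) →-dec (¬? (y ≟ᶠ z) →-dec no id))))))

-- The bipartition left by a transversal, and recolouring when it has maximum degree 2.

record Sides {n} (G : Graph (Fin n)) (k : ℕ) : Set where
  field
    -- The bipartition of the graph minus a transversal, on which side is nothing.
    side  : Fin n → Maybe Bool
    indep : ∀ {b u v} → side u ≡ just b → side v ≡ just b → ¬ _~_ G u v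
    few   : AtMost k (λ v → side v ≡ nothing)

  infix 4 _on_
  _on_ : Fin n → Bool → Set
  v on b = side v ≡ just b

  _on?_ : ∀ v b → Dec (v on b)
  v on? b = maybe-≟ _≟ᵇ_ (side v) (just b)

  off? : ∀ v → Dec (side v ≡ nothing)
  off? v = maybe-≟ _≟ᵇ_ (side v) nothing

  Heavy : Fin n → Bool → Set
  Heavy u b = Many 3 (λ v → v on b × _~_ G u v)

  heavy? : ∀ u b → Dec (Heavy u b)
  heavy? u b = many? (λ v → (v on? b) ×-dec _~?_ G u v) 2

  light : ∀ {u b} → ¬ Heavy u b → AtMost 2 (λ v → v on b × _~_ G u v)
  light {u} {b} = ¬many⇒atMost λ v → (v on? b) ×-dec _~?_ G u v

  heavy⇒few-nonneighbours : ∀ {s} → ((star 3 +ᴳ copies s (path 1)) -Free) G →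
                            ∀ {u b} → Heavy u b → AtMost s (λ v → v on b × ¬ _~_ G u v)
  heavy⇒few-nonneighbours {s} free {u} {b} heavy = ¬many⇒atMost (λ v → (v on? b) ×-dec ¬? (_~?_ G u v))
    -- The negated bound supplies `suc s` non-neighbours, of which one is dropped; this keeps the
    -- bound `s` uniform down to `s` equal to 0.
    λ { (g , g-inj , g∈) → free (claw+sP₁ G indep heavy (g ∘ inject₁ , inject₁-injective ∘ g-inj , g∈ ∘ inject₁)) }

  on⇒≢nothing : ∀ {v b} → v on b → side v ≢ nothing
  on⇒≢nothing v∈ v∉ = contradiction (trans (sym v∈) v∉) λ ()

  off-or-on : ∀ v → side v ≡ nothing ⊎ ∃[ b ] (v on b)
  off-or-on v with side v
  ... | nothing = inj₁ refl
  ... | just b  = inj₂ (b , refl)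

  across : ∀ {b u v} → u on b → _~_ G u v → side v ≢ nothing → v on not b
  across {b} {u} {v} u∈ uv v≢ with side v in v∈
  ... | nothing = ⊥-elim (v≢ refl)
  ... | just b′ = cong just (¬-not λ { refl → indep u∈ v∈ uv })

module _ {n k : ℕ} {G : Graph (Fin n)} (sides : Sides G k) where

  open Sides sides

  module _ {D : Pred (Fin n) 0ℓ} (D? : Decidable D) where

    private
      side′ : Fin n → Maybe Bool
      side′ v = if does (D? v) then nothing else side v

    kept : ∀ {v b} → side′ v ≡ just b → v on b × ¬ D v
    kept {v} e with D? v
    ... | no ¬Dv = e , ¬Dv

    restrict : ∀ {m} → AtMost m D → Sides G (k + m)
    restrict fewD = record
      { side  = side′
      ; indep = λ u∈ v∈ → indep (proj₁ (kept u∈)) (proj₁ (kept v∈))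
      ; few   = atMost-⊆ removed (atMost-∪ few fewD) }
      where
      removed : ∀ v → side′ v ≡ nothing → side v ≡ nothing ⊎ D v
      removed v e with D? v
      ... | yes Dv = inj₂ Dv
      ... | no  _  = inj₁ e

-- Each of the `k` deleted vertices is irregular to at most `s + 2` vertices per side: a heavy one
-- misses at most `s`, a light one sees at most 2. `sparse≤` adds up the deleted vertices, the
-- attached ones and at most two neighbours of each attached one.
attached≤ sparse≤ : ℕ → ℕ → ℕ
attached≤ s k = k * ((s + 2) + (s + 2))
sparse≤   s k = k + (attached≤ s k + attached≤ s k * 2)

module SparseSides {n s : ℕ} {G : Graph (Fin n)} (free : ((star 3 +ᴳ copies s (path 1)) -Free) G)
  {c : Fin n → Fin 3} (proper : Proper G c) {k : ℕ} (sides : Sides G k)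
  (sparse : ∀ {u : Fin n} {b : Bool} → Sides._on_ sides u b → AtMost 2 (λ v → Sides._on_ sides v (not b) × _~_ G u v)) where

  open Sides sides

  Irregular : Fin n → Fin n → Bool → Set
  Irregular r v b = v on b × ((Heavy r b × ¬ _~_ G r v) ⊎ (¬ Heavy r b × _~_ G r v))

  irregular-few : ∀ r b → AtMost (s + 2) (λ v → Irregular r v b)
  irregular-few r b with heavy? r b
  ... | yes heavy = atMost-≤ (m≤m+n s 2) (atMost-⊆
          (λ { v (v∈ , inj₁ (_ , ¬rv)) → v∈ , ¬rv ; v (_ , inj₂ (¬heavy , _)) → ⊥-elim (¬heavy heavy) })
          (heavy⇒few-nonneighbours free heavy))
  ... | no ¬heavy = atMost-≤ (m≤n+m 2 s) (atMost-⊆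
          (λ { v (_ , inj₁ (heavy , _)) → ⊥-elim (¬heavy heavy) ; v (v∈ , inj₂ (_ , rv)) → v∈ , rv })
          (light ¬heavy))

  Attached : Fin n → Set
  Attached v = ∃[ r ] (side r ≡ nothing × ∃[ b ] Irregular r v b)

  attached? : ∀ v → Dec (Attached v)
  attached? v = any? λ r → off? r ×-dec
    map′ [ (true ,_) , (false ,_) ] (λ { (true , i) → inj₁ i ; (false , i) → inj₂ i })
         (irregular? r true ⊎-dec irregular? r false)
    where
    irregular? : ∀ r b → Dec (Irregular r v b)
    irregular? r b = (v on? b) ×-dec ((heavy? r b ×-dec ¬? (_~?_ G r v)) ⊎-dec (¬? (heavy? r b) ×-dec _~?_ G r v))

  attached-few : AtMost (attached≤ s k) Attached
  attached-few = atMost-⋃ (λ r v → ∃[ b ] Irregular r v b) few λ r →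
    atMost-⊆ (λ { v (true , i) → inj₁ i ; v (false , i) → inj₂ i }) (atMost-∪ (irregular-few r true) (irregular-few r false))

  module _ {r v : Fin n} {b : Bool} (r∉ : side r ≡ nothing) (v∈ : v on b) (¬att : ¬ Attached v) where

    regular-heavy : Heavy r b → _~_ G r v
    regular-heavy heavy = decidable-stable (_~?_ G r v) λ ¬rv → ¬att (r , r∉ , b , v∈ , inj₁ (heavy , ¬rv))

    regular-adjacent : _~_ G r v → Heavy r b
    regular-adjacent rv = decidable-stable (heavy? r b) λ ¬heavy → ¬att (r , r∉ , b , v∈ , inj₂ (¬heavy , rv))

  -- All unattached vertices of side `b` are adjacent to the same deleted vertices, so this is a
  -- property of the side and not of the vertex.
  Forbidden : Bool → Fin 3 → Set
  Forbidden b i = ∃[ r ] (side r ≡ nothing × Heavy r b × c r ≡ i)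

  forbidden? : ∀ b i → Dec (Forbidden b i)
  forbidden? b i = any? λ r → off? r ×-dec heavy? r b ×-dec (c r ≟ᶠ i)

  F : Bool → Fin 3 → Bool
  F b i = does (forbidden? b i)

  -- The old colouring itself shows that a side with an unattached vertex has a usable colour. This
  -- is the premise under which `Choice` makes its promises about a side.
  available : ∀ {v b} → v on b → ¬ Attached v → F b (c v) ≡ false
  available {v} {b} v∈ ¬att = dec-false (forbidden? b (c v)) λ { (r , r∉ , heavy , cr≡cv) →
    proper r v (regular-heavy r∉ v∈ ¬att heavy) cr≡cv }

  forbidden-twice : ∀ {i} → (∀ b → F b i ≡ true) → Recolourable G (k + attached≤ s k)
  forbidden-twice {i} Fi = c , proper , i , atMost-⊆ exceptional (atMost-∪ few attached-few)
    where
    exceptional : ∀ v → c v ≡ i → side v ≡ nothing ⊎ Attached v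
    exceptional v refl with off-or-on v
    ... | inj₁ v∉       = inj₁ v∉
    ... | inj₂ (b , v∈) = inj₂ (decidable-stable (attached? v) λ ¬att →
                      contradiction (trans (sym (Fi b)) (available v∈ ¬att)) λ ())

  Near : Fin n → Set
  Near v = ∃[ p ] (Attached p × _~_ G v p)

  near? : ∀ v → Dec (Near v)
  near? v = any? λ p → attached? p ×-dec _~?_ G v p

  attached⇒on : ∀ {p} → Attached p → side p ≢ nothing
  attached⇒on (_ , _ , _ , p∈ , _) = on⇒≢nothing p∈

  near-few : AtMost (attached≤ s k * 2) (λ v → side v ≢ nothing × Near v)
  near-few = atMost-⊆ (λ { v (v∈ , p , att , vp) → p , att , v∈ , attached⇒on att , ~-sym G vp })
    (atMost-⋃ (λ p v → side v ≢ nothing × side p ≢ nothing × _~_ G p v) attached-few each)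
    where
    each : ∀ p → AtMost 2 (λ v → side v ≢ nothing × side p ≢ nothing × _~_ G p v)
    each p with off-or-on p
    ... | inj₁ p∉       = atMost-∅ λ { _ (_ , p≢ , _) → p≢ p∉ }
    ... | inj₂ (b , p∈) = atMost-⊆ (λ { v (v∈ , _ , pv) → across p∈ pv v∈ , pv }) (sparse p∈)

  Distant : Fin n → Set
  Distant w = side w ≢ nothing × ¬ Attached w × ¬ Near w

  distant? : ∀ w → Dec (Distant w)
  distant? w = ¬? (off? w) ×-dec ¬? (attached? w) ×-dec ¬? (near? w)

  -- Short gaps between attached vertices keep their colours; a longer path
  -- leaving an attached vertex first uses a transition colour.
  Gap : Fin n → Set
  Gap v = Near v × ¬ (∃[ w ] (_~_ G v w × Distant w))

  gap? : ∀ v → Dec (Gap v)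
  gap? v = near? v ×-dec ¬? (any? λ w → _~?_ G v w ×-dec distant? w)

  Old : Fin n → Set
  Old v = side v ≡ nothing ⊎ Attached v ⊎ Gap v

  old? : ∀ v → Dec (Old v)
  old? v = off? v ⊎-dec attached? v ⊎-dec gap? v

  three-neighbours : ∀ {b v x y z} → v on b → _~_ G v x → _~_ G v y → _~_ G v z →
    side x ≢ nothing → side y ≢ nothing → side z ≢ nothing → x ≢ y → x ≢ z → y ≢ z → ⊥
  three-neighbours v∈ vx vy vz x∈ y∈ z∈ x≢y x≢z y≢z = ¬atMost∧many (sparse v∈)
    (many₃ x≢y x≢z y≢z (across v∈ vx x∈ , vx) (across v∈ vy y∈ , vy) (across v∈ vz z∈ , vz))

  ¬gap⇒distant : ∀ {v} → Near v → ¬ Gap v → ∃[ w ] (_~_ G v w × Distant w)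
  ¬gap⇒distant {v} near ¬gap = decidable-stable (any? λ w → _~?_ G v w ×-dec distant? w) λ none → ¬gap (near , none)

  -- Not being a gap gives `v` a distant neighbour besides `p`; degree at most 2 leaves no room for
  -- a third.
  only-neighbours : ∀ {b v p u} → v on b → ¬ Gap v → Attached p → _~_ G v p → side u ≢ nothing → _~_ G v u →
                    ¬ Distant u → u ≡ p
  only-neighbours {v = v} {p} {u} v∈ ¬gap att vp u∈ vu ¬dist with ¬gap⇒distant (p , att , vp) ¬gap
  ... | w , vw , dist@(w∈ , ¬attw , _) = decidable-stable (u ≟ᶠ p) λ u≢p →
    three-neighbours v∈ vu vp vw u∈ (attached⇒on att) w∈ u≢p (λ { refl → ¬dist dist }) λ { refl → ¬attw att }

  module Recolour (γ : Fin 3) (α : Bool → Fin 3) (α≢α : ∀ b → α b ≢ α (not b)) (α≢γ : ∀ b → α b ≢ γ)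
    (ok : ∀ b i → F b i ≡ false → F b (α b) ≡ false × (F b γ ≡ false ⊎ F b (α (not b)) ≡ true)) where

    Conflict : Bool → Fin n → Set
    Conflict b v = ∃[ p ] (Attached p × _~_ G v p × c p ≡ α b)

    conflict? : ∀ b v → Dec (Conflict b v)
    conflict? b v = any? λ p → attached? p ×-dec _~?_ G v p ×-dec (c p ≟ᶠ α b)

    -- The new colouring as a relation that records which rule was applied, so that properness on an
    -- edge is a case split on the rules at its ends.
    data NewColour (v : Fin n) : Fin 3 → Set where
      old      : Old v → NewColour v (c v)
      conflict : ∀ b → v on b → ¬ Old v → Conflict b v → NewColour v γ
      regular  : ∀ b → v on b → ¬ Old v → ¬ Conflict b v → NewColour v (α b)

    newColour : ∀ v → ∃[ i ] NewColour v i
    newColour v with old? v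
    ... | yes o = c v , old o
    ... | no ¬o with off-or-on v
    ...   | inj₁ v∉ = ⊥-elim (¬o (inj₁ v∉))
    ...   | inj₂ (b , v∈) with conflict? b v
    ...     | yes cf = γ , conflict b v∈ ¬o cf
    ...     | no ¬cf = α b , regular b v∈ ¬o ¬cf

    -- If `γ` were forbidden on side `b`, then `ok` makes `α (not b)` forbidden too. The old colour
    -- of `v` avoids both, and it avoids `α b` because of the neighbour `p`; no colour would remain.
    conflict-available : ∀ {b v} → v on b → ¬ Attached v → Conflict b v → F b γ ≡ false
    conflict-available {b} {v} v∈ ¬att (p , _ , vp , cp) with ok b (c v) (available v∈ ¬att)
    ... | _ , inj₁ Fγ = Fγ
    ... | _ , inj₂ Fα with F b γ in Fγ
    ...   | false = refl
    ...   | true  = ⊥-elim (four-colours (c v) (α b) (α (not b)) γ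
              (λ e → proper v p vp (trans e (sym cp)))
              (λ e → contradiction (trans (sym Fα) (trans (cong (F b) (sym e)) (available v∈ ¬att))) λ ())
              (λ e → contradiction (trans (sym Fγ) (trans (cong (F b) (sym e)) (available v∈ ¬att))) λ ())
              (α≢α b) (α≢γ b) (α≢γ (not b)))

    off-new : ∀ {b u v i} → side u ≡ nothing → v on b → ¬ Attached v → _~_ G u v → F b i ≡ false → c u ≢ i
    off-new u∉ v∈ ¬att uv Fi refl =
      contradiction (trans (sym (dec-true (forbidden? _ _) (_ , u∉ , regular-adjacent u∉ v∈ ¬att uv , refl))) Fi) λ ()

    attached-conflict : ∀ {b u v} → v on b → ¬ Gap v → Attached u → _~_ G u v → Conflict b v → c u ≢ γ
    attached-conflict {b} {u} {v} v∈ ¬gap att uv (p , attp , vp , cp) cu =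
      α≢γ b (trans (sym cp) (subst (λ w → c w ≡ γ)
        (only-neighbours v∈ ¬gap attp vp (attached⇒on att) (~-sym G uv) λ { (_ , ¬att , _) → ¬att att }) cu))

    -- If `v` is not near, it is a distant neighbour of the gap vertex `u`, which a gap does not
    -- have. If `v` is near, its only neighbour on the sides that is not distant is attached, and
    -- `u` would have to be that one.
    gap-new : ∀ {b u v} → v on b → ¬ Attached v → ¬ Gap v → side u ≢ nothing → Gap u → ¬ Attached u → _~_ G u v → ⊥
    gap-new {b} {u} {v} v∈ ¬attv ¬gapv u∈ (nearu , none) ¬attu uv with near? v
    ... | no ¬near = none (v , uv , on⇒≢nothing v∈ , ¬attv , ¬near)
    ... | yes (p , attp , vp) = ¬attu (subst Attached (sym
            (only-neighbours v∈ ¬gapv attp vp u∈ (~-sym G uv) λ { (_ , _ , ¬near) → ¬near nearu })) attp)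

    old-conflict : ∀ {b u v} → Old u → v on b → ¬ Old v → Conflict b v → _~_ G u v → c u ≢ γ
    old-conflict (inj₁ u∉) v∈ ¬o cf uv =
      off-new u∉ v∈ (¬o ∘ inj₂ ∘ inj₁) uv (conflict-available v∈ (¬o ∘ inj₂ ∘ inj₁) cf)
    old-conflict (inj₂ (inj₁ att)) v∈ ¬o cf uv = attached-conflict v∈ (¬o ∘ inj₂ ∘ inj₂) att uv cf
    -- A gap vertex may also be attached or deleted, and these cases go first.
    old-conflict {u = u} (inj₂ (inj₂ gap)) v∈ ¬o cf uv with attached? u | off? u
    ... | yes att | _ = attached-conflict v∈ (¬o ∘ inj₂ ∘ inj₂) att uv cf
    ... | no _ | yes u∉ = old-conflict (inj₁ u∉) v∈ ¬o cf uv
    ... | no ¬att | no u∈ = ⊥-elim (gap-new v∈ (¬o ∘ inj₂ ∘ inj₁) (¬o ∘ inj₂ ∘ inj₂) u∈ gap ¬att uv)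

    old-regular : ∀ {b u v} → Old u → v on b → ¬ Old v → ¬ Conflict b v → _~_ G u v → c u ≢ α b
    old-regular (inj₁ u∉) v∈ ¬o _ uv =
      off-new u∉ v∈ (¬o ∘ inj₂ ∘ inj₁) uv (proj₁ (ok _ _ (available v∈ (¬o ∘ inj₂ ∘ inj₁))))
    old-regular (inj₂ (inj₁ att)) v∈ ¬o ¬cf uv cu = ¬cf (_ , att , ~-sym G uv , cu)
    old-regular {u = u} (inj₂ (inj₂ gap)) v∈ ¬o ¬cf uv with attached? u | off? u
    ... | yes att | _ = old-regular (inj₂ (inj₁ att)) v∈ ¬o ¬cf uv
    ... | no _ | yes u∉ = old-regular (inj₁ u∉) v∈ ¬o ¬cf uv
    ... | no ¬att | no u∈ = ⊥-elim (gap-new v∈ (¬o ∘ inj₂ ∘ inj₁) (¬o ∘ inj₂ ∘ inj₂) u∈ gap ¬att uv)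

    newColour-proper : ∀ {u v i j} → _~_ G u v → NewColour u i → NewColour v j → i ≢ j
    newColour-proper uv (old _) (old _) = proper _ _ uv
    newColour-proper uv (old ou) (conflict b v∈ ¬ov cf) = old-conflict ou v∈ ¬ov cf uv
    newColour-proper uv (old ou) (regular b v∈ ¬ov ¬cf) = old-regular ou v∈ ¬ov ¬cf uv
    newColour-proper uv (conflict b u∈ ¬ou cf) (old ov) = ≢-sym (old-conflict ov u∈ ¬ou cf (~-sym G uv))
    newColour-proper uv (regular b u∈ ¬ou ¬cf) (old ov) = ≢-sym (old-regular ov u∈ ¬ou ¬cf (~-sym G uv))
    -- The vertex `v` is near, hence not distant, hence equal to the attached neighbour of `u`; but
    -- then it keeps its old colour.
    newColour-proper uv (conflict b u∈ ¬ou (p , attp , up , _)) (conflict b′ v∈ ¬ov (q , attq , vq , _)) _ =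
      ¬ov (inj₂ (inj₁ (subst Attached (sym (only-neighbours u∈ (¬ou ∘ inj₂ ∘ inj₂) attp up (on⇒≢nothing v∈) uv
        λ { (_ , _ , ¬near) → ¬near (q , attq , vq) })) attp)))
    newColour-proper uv (conflict _ _ _ _) (regular b _ _ _) = ≢-sym (α≢γ b)
    newColour-proper uv (regular b _ _ _) (conflict _ _ _ _) = α≢γ b
    newColour-proper uv (regular b u∈ _ _) (regular b′ v∈ _ _)
      with refl ← just-injective (trans (sym v∈) (across u∈ uv (on⇒≢nothing v∈))) = α≢α b

    recolour : Recolourable G (sparse≤ s k)
    recolour = proj₁ ∘ newColour , (λ u v uv → newColour-proper uv (proj₂ (newColour u)) (proj₂ (newColour v))) ,
      γ , atMost-⊆ (λ v → exceptional v (proj₂ (newColour v))) (atMost-∪ few (atMost-∪ attached-few near-few))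
      where
      exceptional : ∀ v {i} → NewColour v i → i ≡ γ → side v ≡ nothing ⊎ Attached v ⊎ side v ≢ nothing × Near v
      exceptional v (old (inj₁ v∉)) _ = inj₁ v∉
      exceptional v (old (inj₂ (inj₁ att))) _ = inj₂ (inj₁ att)
      exceptional v (old (inj₂ (inj₂ (near , _)))) _ with off? v
      ... | yes v∉ = inj₁ v∉
      ... | no v∈  = inj₂ (inj₂ (v∈ , near))
      exceptional v (conflict b v∈ _ (p , att , vp , _)) _ = inj₂ (inj₂ (on⇒≢nothing v∈ , p , att , vp))
      exceptional v (regular b _ _ _) e = ⊥-elim (α≢γ b e)

  sparse-recolourable : Recolourable G (sparse≤ s k)
  sparse-recolourable = by-choice (choice F)
    where
    by-choice : Choice F → Recolourable G (sparse≤ s k)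
    by-choice (inj₁ (i , Fi)) = recolourable-≤ {G = G} (+-monoʳ-≤ k (m≤m+n _ _)) (forbidden-twice Fi)
    by-choice (inj₂ (γ , αt , αf , t≢f , t≢γ , f≢γ , okt , okf)) = Recolour.recolour γ (λ { true → αt ; false → αf })
      (λ { true → t≢f ; false → ≢-sym t≢f }) (λ { true → t≢γ ; false → f≢γ }) λ { true → okt ; false → okf }

-- Merging two colours in the dense case, and the case distinction by heavy vertices.

pigeonhole₃ : ∀ {P : Fin 3 → Bool → Set} → (∀ i → ∃ (P i)) → ∃[ i ] ∃[ j ] ∃[ b ] (i ≢ j × P i b × P j b)
pigeonhole₃ P with P zero | P (suc zero) | P (suc (suc zero))
... | true  , p | true  , q | _         = zero , suc zero , true , (λ ()) , p , q
... | false , p | false , q | _         = zero , suc zero , false , (λ ()) , p , q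
... | true  , p | false , _ | true  , r = zero , suc (suc zero) , true , (λ ()) , p , r
... | false , p | true  , _ | false , r = zero , suc (suc zero) , false , (λ ()) , p , r
... | true  , _ | false , q | false , r = suc zero , suc (suc zero) , false , (λ ()) , q , r
... | false , _ | true  , q | true  , r = suc zero , suc (suc zero) , true , (λ ()) , q , r

-- The bounds of `heavy-outside` and `all-light`, added in place of a maximum; `bound≤` adds the
-- three final cases in the same way.
merged≤ : ℕ → ℕ → ℕ
merged≤ s k = ((k + (s + s + s)) + s) + ((k + (s + s + s)) + (k + (s + s + s)) * 2)

bound≤ : ℕ → ℕ → ℕ
bound≤ s k = (sparse≤ s (k + (2 + 2)) + sparse≤ s (k + ((s + s + s) + 2))) + merged≤ s k

module DenseSides {n s : ℕ} {G : Graph (Fin n)} (free : ((star 3 +ᴳ copies s (path 1)) -Free) G)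
  {c : Fin n → Fin 3} (proper : Proper G c) {k : ℕ} (sides : Sides G k) where

  open Sides sides

  3s : ℕ
  3s = s + s + s

  Rare : Fin 3 → Bool → Set
  Rare i b = AtMost 3s (λ v → v on b × c v ≡ i)

  off-or-either : ∀ b v → side v ≡ nothing ⊎ v on b ⊎ v on not b
  off-or-either b v with off-or-on v
  ... | inj₁ v∉ = inj₁ v∉
  ... | inj₂ (b′ , v∈) with b′ ≟ᵇ b
  ...   | yes refl = inj₂ (inj₁ v∈)
  ...   | no b′≢b  = inj₂ (inj₂ (subst (v on_) (¬-not b′≢b) v∈))

  -- The vertices of colour j on the other side are recoloured i.
  module Merge {i j : Fin 3} {b : Bool} (i≢j : i ≢ j) (rare-i : Rare i b) (rare-j : Rare j b) where

    Outside : Fin 3 → Fin n → Set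
    Outside i v = c v ≡ i × (side v ≡ nothing ⊎ v on b)

    outside? : ∀ i v → Dec (Outside i v)
    outside? i v = (c v ≟ᶠ i) ×-dec (off? v ⊎-dec (v on? b))

    outside-few : ∀ {i} → Rare i b → AtMost (k + 3s) (Outside i)
    outside-few rare = atMost-⊆ (λ { v (cv , inj₁ v∉) → inj₁ v∉ ; v (cv , inj₂ v∈) → inj₂ (v∈ , cv) }) (atMost-∪ few rare)

    -- All but `s` vertices of the opposite side are adjacent to `v` and so do not have its colour
    -- `i`. Colour `i` is therefore already rare everywhere.
    heavy-outside : ∀ {v} → Outside i v → Heavy v (not b) → Recolourable G (k + 3s + s)
    heavy-outside {v} (cv , _) heavy = c , proper , i ,
      atMost-⊆ (λ w cw → place w cw (off-or-either b w)) (atMost-∪ (outside-few rare-i) (heavy⇒few-nonneighbours free heavy))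
      where
      place : ∀ w → c w ≡ i → side w ≡ nothing ⊎ w on b ⊎ w on not b → Outside i w ⊎ (w on not b × ¬ _~_ G v w)
      place w cw (inj₁ w∉)        = inj₁ (cw , inj₁ w∉)
      place w cw (inj₂ (inj₁ w∈)) = inj₁ (cw , inj₂ w∈)
      place w cw (inj₂ (inj₂ w∈)) = inj₂ (w∈ , λ vw → proper v w vw (trans cv (sym cw)))

    Blocked : Fin n → Set
    Blocked v = ∃[ w ] (Outside i w × _~_ G w v)

    Moves : Fin n → Set
    Moves v = v on not b × c v ≡ j × ¬ Blocked v

    moves? : ∀ v → Dec (Moves v)
    moves? v = (v on? not b) ×-dec (c v ≟ᶠ j) ×-dec ¬? (any? λ w → outside? i w ×-dec _~?_ G w v)

    mover-stayer : ∀ {u v} → Moves u → _~_ G u v → c v ≢ i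
    mover-stayer {v = v} (u∈ , _ , ¬blocked) uv cv with off-or-either b v
    ... | inj₁ v∉        = ¬blocked (v , (cv , inj₁ v∉) , ~-sym G uv)
    ... | inj₂ (inj₁ v∈) = ¬blocked (v , (cv , inj₂ v∈) , ~-sym G uv)
    ... | inj₂ (inj₂ v∈) = indep u∈ v∈ uv

    moved : ∀ v → Dec (Moves v) → Fin 3
    moved v (yes _) = i
    moved v (no _)  = c v

    moved-proper : ∀ {u v} (mu : Dec (Moves u)) (mv : Dec (Moves v)) → _~_ G u v → moved u mu ≢ moved v mv
    moved-proper (yes mu) (yes mv) uv _  = indep (proj₁ mu) (proj₁ mv) uv
    moved-proper (yes mu) (no _)   uv eq = mover-stayer mu uv (sym eq)
    moved-proper (no _)   (yes mv) uv eq = mover-stayer mv (~-sym G uv) eq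
    moved-proper (no _)   (no _)   uv eq = proper _ _ uv eq

    -- A vertex of colour `j` is held back only by a neighbour of colour `i` outside its side. There
    -- are at most `k + 3s` of these, each light and so blocking at most 2 vertices. What remains of
    -- class `j` is the blocked vertices and the members outside.
    all-light : (∀ v → Outside i v → ¬ Heavy v (not b)) → Recolourable G ((k + 3s) + (k + 3s) * 2)
    all-light ¬heavy = (λ v → moved v (moves? v)) , (λ u v → moved-proper (moves? u) (moves? v)) ,
      j , atMost-⊆ (λ v → exceptional v (moves? v)) (atMost-∪ (outside-few rare-j)
      (atMost-⋃ (λ w v → Outside i w × v on not b × _~_ G w v) (outside-few rare-i) each))
      where
      exceptional : ∀ v (mv : Dec (Moves v)) → moved v mv ≡ j →
                    Outside j v ⊎ ∃[ w ] (Outside i w × Outside i w × v on not b × _~_ G w v)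
      exceptional v (yes _) e = ⊥-elim (i≢j e)
      exceptional v (no ¬moves) e with off-or-either b v
      ... | inj₁ v∉        = inj₁ (e , inj₁ v∉)
      ... | inj₂ (inj₁ v∈) = inj₁ (e , inj₂ v∈)
      ... | inj₂ (inj₂ v∈) with any? (λ w → outside? i w ×-dec _~?_ G w v)
      ...   | yes (w , out , wv) = inj₂ (w , out , out , v∈ , wv)
      ...   | no ¬blocked        = ⊥-elim (¬moves (v∈ , e , ¬blocked))
      each : ∀ w → AtMost 2 (λ v → Outside i w × v on not b × _~_ G w v)
      each w with outside? i w
      ... | no ¬out = atMost-∅ λ { _ (out , _) → ¬out out }
      ... | yes out = atMost-⊆ (λ { _ (_ , v∈ , wv) → v∈ , wv }) (light (¬heavy w out))

    merge : Recolourable G (merged≤ s k)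
    merge with any? (λ v → outside? i v ×-dec heavy? v (not b))
    ... | yes (v , out , heavy) = recolourable-≤ {G = G} (m≤m+n _ _) (heavy-outside out heavy)
    ... | no ¬heavy = recolourable-≤ {G = G} (m≤n+m _ (k + 3s + s)) (all-light λ v out heavy → ¬heavy (v , out , heavy))

  HeavyOn : Bool → Fin n → Set
  HeavyOn b v = v on b × Heavy v (not b)

  heavyOn? : ∀ b → Decidable (HeavyOn b)
  heavyOn? b v = (v on? b) ×-dec heavy? v (not b)

  LightOn : Bool → Fin n → Set
  LightOn b v = v on b × ¬ Heavy v (not b)

  -- All but 3s vertices of the other side are adjacent to all three, hence heavy.
  three-heavy : ∀ b → Many 3 (λ v → v on b × Heavy v (not b)) → AtMost 3s (λ v → v on not b × ¬ Heavy v b)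
  three-heavy b (f , f-inj , f∈) = atMost-⊆ misses (atMost-∪ (atMost-∪ (nonneighbours zero) (nonneighbours (suc zero))) (nonneighbours (suc (suc zero))))
    where
    Miss : Fin 3 → Fin n → Set
    Miss i v = v on not b × ¬ _~_ G (f i) v
    nonneighbours : ∀ i → AtMost s (Miss i)
    nonneighbours i = heavy⇒few-nonneighbours free (proj₂ (f∈ i))
    misses : ∀ v → v on not b × ¬ Heavy v b → (Miss zero v ⊎ Miss (suc zero) v) ⊎ Miss (suc (suc zero)) v
    misses v (v∈ , ¬heavy) with all? (λ i → _~?_ G (f i) v)
    ... | yes adj = ⊥-elim (¬heavy (f , f-inj , λ i → proj₁ (f∈ i) , ~-sym G (adj i)))
    ... | no ¬adj with _~?_ G (f zero) v | _~?_ G (f (suc zero)) v | _~?_ G (f (suc (suc zero))) v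
    ...   | no ¬a | _     | _     = inj₁ (inj₁ (v∈ , ¬a))
    ...   | yes _ | no ¬a | _     = inj₁ (inj₂ (v∈ , ¬a))
    ...   | yes _ | yes _ | no ¬a = inj₂ (v∈ , ¬a)
    ...   | yes x | yes y | yes z = ⊥-elim (¬adj λ { zero → x ; (suc zero) → y ; (suc (suc zero)) → z })

  -- Every colour is rare on some side. If a heavy vertex on `true` has it, at most `s` vertices on
  -- `false` can have it; otherwise on `true` only light vertices have it. With three colours and
  -- two sides, two colours are rare on a common side.
  dense : AtMost 3s (LightOn true) → Recolourable G (merged≤ s k)
  dense fewLight with pigeonhole₃ {Rare} rare
    where
    rare : ∀ i → ∃ (Rare i)
    rare i with any? (λ v → heavyOn? true v ×-dec (c v ≟ᶠ i))
    ... | yes (v , (_ , heavy) , cv) = false , atMost-≤ (m≤n+m s (s + s))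
            (atMost-⊆ (λ { w (w∈ , cw) → w∈ , λ vw → proper v w vw (trans cv (sym cw)) }) (heavy⇒few-nonneighbours free heavy))
    ... | no ¬heavy = true , atMost-⊆ (λ { w (w∈ , cw) → w∈ , λ heavy → ¬heavy (w , (w∈ , heavy) , cw) }) fewLight
  ... | i , j , b , i≢j , rare-i , rare-j = Merge.merge i≢j rare-i rare-j

  few-heavy : AtMost 2 (HeavyOn true) → AtMost 2 (HeavyOn false) → Recolourable G (sparse≤ s (k + (2 + 2)))
  few-heavy fewT fewF = SparseSides.sparse-recolourable free proper sides′ sparse
    where
    anyHeavy? : Decidable (λ v → HeavyOn true v ⊎ HeavyOn false v)
    anyHeavy? v = heavyOn? true v ⊎-dec heavyOn? false v
    few′ : AtMost (2 + 2) (λ v → HeavyOn true v ⊎ HeavyOn false v)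
    few′ = atMost-∪ fewT fewF
    sides′ : Sides G (k + (2 + 2))
    sides′ = restrict sides anyHeavy? few′
    sparse : ∀ {u b} → Sides._on_ sides′ u b → AtMost 2 (λ v → Sides._on_ sides′ v (not b) × _~_ G u v)
    sparse {u} {b} u∈ with kept {G = G} sides anyHeavy? {b = b} u∈
    ... | u∈ , ¬heavy = atMost-⊆ (λ { v (v∈ , uv) → proj₁ (kept {G = G} sides anyHeavy? {b = not b} v∈) , uv }) (light (¬heavy ∘ on b u∈))
      where
      on : ∀ b → u on b → Heavy u (not b) → HeavyOn true u ⊎ HeavyOn false u
      on true  u∈ heavy = inj₁ (u∈ , heavy)
      on false u∈ heavy = inj₂ (u∈ , heavy)

  -- Once one side is deleted the other is independent, which is sparse in the strongest sense.
  small-side : ∀ b {m} → AtMost m (_on b) → Recolourable G (sparse≤ s (k + m))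
  small-side b {m} few′ = SparseSides.sparse-recolourable free proper sides′ sparse
    where
    sides′ : Sides G (k + m)
    sides′ = restrict sides (_on? b) few′
    sparse : ∀ {u b′} → Sides._on_ sides′ u b′ → AtMost 2 (λ v → Sides._on_ sides′ v (not b′) × _~_ G u v)
    sparse {b′ = b′} u∈ = atMost-∅ λ { v (v∈ , uv) → both (kept {G = G} sides (_on? b) {b = b′} u∈) (kept {G = G} sides (_on? b) {b = not b′} v∈) }
      where
      both : ∀ {u v b′} → u on b′ × ¬ (u on b) → v on not b′ × ¬ (v on b) → ⊥
      both {b′ = b′} (u∈ , ¬u) (v∈ , ¬v) with b′ ≟ᵇ b
      ... | yes refl = ¬u u∈
      ... | no b′≢b  = ¬v (subst (_ on_) (sym (¬-not (≢-sym b′≢b))) v∈)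

  -- With at most two heavy vertices on each side, deleting these four reaches degree 2. If exactly
  -- one side has three, they make all but `3s` vertices of the other side heavy, and at most two
  -- are heavy there, so that side has at most `3s + 2` vertices and is deleted. If both sides have
  -- three, two colours are merged.
  claw-recolourable : Recolourable G (bound≤ s k)
  claw-recolourable with atMost⊎many (heavyOn? true) 2 | atMost⊎many (heavyOn? false) 2
  ... | inj₁ fewT  | inj₁ fewF  = recolourable-≤ {G = G} (≤-trans (m≤m+n _ _) (m≤m+n _ _)) (few-heavy fewT fewF)
  ... | inj₂ manyT | inj₁ fewF  = recolourable-≤ {G = G} (≤-trans (m≤n+m _ (sparse≤ s (k + (2 + 2)))) (m≤m+n _ _))
          (small-side false (atMost-⊆ (λ v v∈ → split v v∈ (heavy? v true)) (atMost-∪ (three-heavy true manyT) fewF)))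
    where
    split : ∀ v → v on false → Dec (Heavy v true) → (v on false × ¬ Heavy v true) ⊎ HeavyOn false v
    split v v∈ (yes heavy) = inj₂ (v∈ , heavy)
    split v v∈ (no ¬heavy) = inj₁ (v∈ , ¬heavy)
  ... | inj₁ fewT  | inj₂ manyF = recolourable-≤ {G = G} (≤-trans (m≤n+m _ (sparse≤ s (k + (2 + 2)))) (m≤m+n _ _))
          (small-side true (atMost-⊆ (λ v v∈ → split v v∈ (heavy? v false)) (atMost-∪ (three-heavy false manyF) fewT)))
    where
    split : ∀ v → v on true → Dec (Heavy v false) → (v on true × ¬ Heavy v false) ⊎ HeavyOn true v
    split v v∈ (yes heavy) = inj₂ (v∈ , heavy)
    split v v∈ (no ¬heavy) = inj₁ (v∈ , ¬heavy)
  ... | inj₂ _     | inj₂ manyF = recolourable-≤ {G = G} (m≤n+m _ (sparse≤ s (k + (2 + 2)) + sparse≤ s (k + (3s + 2)))) (dense (three-heavy false manyF))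

oct-sides : ∀ {n} {G : Graph (Fin n)} {S} → OddCycleTransversal G S → Sides G ∣ S ∣
oct-sides {n} {G} {S} (d , d-proper) = record
  { side  = λ v → side v (v ∈ˢ? S)
  ; indep = λ {b} {u} {v} → indep (u ∈ˢ? S) (v ∈ˢ? S)
  ; few   = atMost-⊆ (λ v → off (v ∈ˢ? S)) (atMost-∈ S) }
  where
  colour : Fin 2 → Bool
  colour zero    = true
  colour (suc _) = false
  colour-injective : ∀ {i j} → colour i ≡ colour j → i ≡ j
  colour-injective {zero} {zero} _ = refl
  colour-injective {suc zero} {suc zero} _ = refl
  side : ∀ v → Dec (v ∈ˢ S) → Maybe Bool
  side v (yes _) = nothing
  side v (no v∉) = just (colour (d (v , v∉)))
  off : ∀ {v} (v∈? : Dec (v ∈ˢ S)) → side v v∈? ≡ nothing → v ∈ˢ S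
  off (yes v∈) _ = v∈
  indep : ∀ {b u v} (u∈? : Dec (u ∈ˢ S)) (v∈? : Dec (v ∈ˢ S)) → side u u∈? ≡ just b → side v v∈? ≡ just b → ¬ _~_ G u v
  indep (no u∉) (no v∉) refl ev uv = d-proper (_ , u∉) (_ , v∉) uv (colour-injective (sym (just-injective ev)))

ioctBounded-claw : ∀ {n s} {H : Graph (Fin n)} → H ⊴ star 3 +ᴳ copies s (path 1) → IoctBounded (FreeThreeColourable H)
ioctBounded-claw {s = s} {H} H⊴ = bound≤ s , λ G (H-free , c , proper) ((S , oct , ∣S∣≡k) , _) ioct →
  recolourable⇒ioct≤ G ioct (subst (Recolourable G ∘ bound≤ s) ∣S∣≡k
    (DenseSides.claw-recolourable {s = s} (H-free ∘ ⊴-trans {F = H} {star 3 +ᴳ copies s (path 1)} {G} H⊴) proper (oct-sides {G = G} oct)))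

-- Graph families with small oct and large ioct

module _ {n : ℕ} {P : Pred (Subset n) 0ℓ} where

  -- For a predicate that is not decided, a minimum is available only up to double negation. This
  -- suffices, since unboundedness is a negation.
  ¬¬-minimum : ∀ {S} → P S → ¬ ¬ (∃[ k ] IsMinSize P k)
  ¬¬-minimum {S} PS none = descend (suc ∣ S ∣) S PS ≤-refl
    where
    descend : ∀ m S → P S → ∣ S ∣ < m → ⊥
    descend (suc m) S PS (s≤s ∣S∣≤m) =
      none (∣ S ∣ , (S , PS , refl) , λ T PT → ≮⇒≥ λ ∣T∣<∣S∣ → descend m T PT (<-≤-trans ∣T∣<∣S∣ ∣S∣≤m))

-- The bounding function need not be monotone and only `oct ≤ a` is known for a family, so all
-- values up to `a` must be exceeded at once.
maxUpTo : (ℕ → ℕ) → ℕ → ℕ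
maxUpTo f zero    = f zero
maxUpTo f (suc a) = f (suc a) ⊔ maxUpTo f a

≤-maxUpTo : ∀ f {a k} → k ≤ a → f k ≤ maxUpTo f a
≤-maxUpTo f {zero}  z≤n = ≤-refl
≤-maxUpTo f {suc a} k≤ with m≤n⇒m<n∨m≡n k≤
... | inj₁ k<   = ≤-trans (≤-maxUpTo f (s≤s⁻¹ k<)) (m≤n⊔m (f (suc a)) _)
... | inj₂ refl = m≤m⊔n _ _

unbounded : ∀ {𝒳 : GraphClass} a →
  (∀ N → ∃[ m ] ∃ λ (G : Graph (Fin m)) → 𝒳 G × Colourable 3 G ×
    (∃[ S ] (OddCycleTransversal G S × ∣ S ∣ ≤ a)) ×
    (∀ S → IndependentOddCycleTransversal G S → N ≤ ∣ S ∣)) →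
  ¬ IoctBounded 𝒳
unbounded a family (f , bound) with family (suc (maxUpTo f a))
... | m , G , G∈𝒳 , (c , proper) , (S , oct , ∣S∣≤a) , large =
  ¬¬-minimum {P = OddCycleTransversal G} oct λ { (k , isOct) →
  ¬¬-minimum {P = IndependentOddCycleTransversal G} (class-ioct G proper zero) λ { (l , isIoct@((T , ioct , refl) , _)) →
    <⇒≱ (≤-trans (large T ioct) (bound G G∈𝒳 isOct isIoct)) (≤-maxUpTo f (≤-trans (proj₂ isOct S oct) ∣S∣≤a)) } }

-- A core of a vertices together with N layers of b vertices each.
Vertices : ℕ → ℕ → ℕ → Set
Vertices a b N = Fin a ⊎ Fin N × Fin b

module _ {a b N : ℕ} where

  encode : Vertices a b N → Fin (a + N * b)
  encode (inj₁ p)       = join a (N * b) (inj₁ p)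
  encode (inj₂ (j , q)) = join a (N * b) (inj₂ (combine j q))

  decode : Fin (a + N * b) → Vertices a b N
  decode = Sum.map₂ (remQuot b) ∘ splitAt a

  decode-encode : ∀ v → decode (encode v) ≡ v
  decode-encode (inj₁ p)       = cong (Sum.map₂ (remQuot b)) (splitAt-join a (N * b) (inj₁ p))
  decode-encode (inj₂ (j , q)) = trans (cong (Sum.map₂ (remQuot b)) (splitAt-join a (N * b) (inj₂ (combine j q))))
                                       (cong inj₂ (remQuot-combine j q))

  encode-decode : ∀ v → encode (decode v) ≡ v
  encode-decode v with splitAt a v | join-splitAt a (N * b) v
  ... | inj₁ p | e = e
  ... | inj₂ r | e = trans (cong (join a (N * b) ∘ inj₂) (combine-remQuot {N} b r)) e

  finite : Graph (Vertices a b N) → Graph (Fin (a + N * b))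
  finite G ._~_ u v    = _~_ G (decode u) (decode v)
  finite G .~-sym      = ~-sym G
  finite G .~-irrefl e = ~-irrefl G (cong decode e)
  finite G ._~?_ u v   = _~?_ G (decode u) (decode v)

  finite-⊴ : ∀ {G : Graph (Vertices a b N)} → finite G ⊴ G
  finite-⊴ = decode , (λ {u} {v} e → trans (sym (encode-decode u)) (trans (cong encode e) (encode-decode v))) ,
             λ _ _ → mk⇔ id id

record Family : Set₁ where
  field
    core layer : ℕ
    graph      : ∀ N → Graph (Vertices core layer N)
    colouring  : ∀ N → Colourable 3 (graph N)
    parity     : ∀ N → ∃ λ (d : Fin N × Fin layer → Fin 2) → ∀ x y → _~_ (graph N) (inj₂ x) (inj₂ y) → d x ≢ d y
    -- Every class of every 3-colouring meets every layer, so ioct ≥ N.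
    ubiquitous : ∀ {N} {c : Vertices core layer N → Fin 3} → Proper (graph N) c → ∀ i j → ¬ (∀ q → c (inj₂ (j , q)) ≢ i)

module Member (F : Family) (N : ℕ) where

  open Family F

  private
    V = Vertices core layer N
    G = graph N

    enc : V → Fin (core + N * layer)
    enc = encode

    dec : Fin (core + N * layer) → V
    dec = decode

    Core : Pred (Fin (core + N * layer)) 0ℓ
    Core v = ∃[ p ] (dec v ≡ inj₁ p)

    core? : Decidable Core
    core? v with dec v
    ... | inj₁ p = yes (p , refl)
    ... | inj₂ _ = no λ ()

  colourable : Colourable 3 (finite G)
  colourable with colouring N
  ... | c , proper = c ∘ dec , λ u v → proper (dec u) (dec v)

  small-oct : ∃[ S ] (OddCycleTransversal (finite G) S × ∣ S ∣ ≤ core)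
  small-oct with parity N
  ... | d , d-proper = ⟦ core? ⟧ , ((λ { (v , v∉) → d (proj₁ (rest v v∉)) }) , proper) ,
    ∣S∣≤ ⟦ core? ⟧ (map (enc ∘ inj₁) (allFin core) , ≤-reflexive (trans (length-map _ (allFin core)) (length-tabulate id)) ,
      λ v v∈ → covered (∈-⟦⟧⁻ core? v∈))
    where
    rest : ∀ v → v ∉ˢ ⟦ core? ⟧ → ∃[ x ] (dec v ≡ inj₂ x)
    rest v v∉ = outer (dec v) refl
      where
      outer : ∀ w → dec v ≡ w → ∃[ x ] (dec v ≡ inj₂ x)
      outer (inj₁ p) e = ⊥-elim (v∉ (∈-⟦⟧⁺ core? (p , e)))
      outer (inj₂ x) e = x , e
    proper : ∀ u v → _~_ (finite G -ᴳ ⟦ core? ⟧) u v →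
             d (proj₁ (rest (proj₁ u) (proj₂ u))) ≢ d (proj₁ (rest (proj₁ v) (proj₂ v)))
    proper (u , u∉) (v , v∉) uv = d-proper _ _ (subst₂ (_~_ G) (proj₂ (rest u u∉)) (proj₂ (rest v v∉)) uv)
    covered : ∀ {v} → Core v → v ∈ map (enc ∘ inj₁) (allFin core)
    covered {v} (p , e) = subst (_∈ map (enc ∘ inj₁) (allFin core)) (trans (cong enc (sym e)) (encode-decode {core} {layer} {N} v))
                                (∈-map⁺ (enc ∘ inj₁) (∈-allFin p))

  -- `S` becomes class `zero` of a proper 3-colouring, with the 2-colouring of the rest shifted by
  -- one. By `ubiquitous` it has a vertex in every layer, and vertices of different layers are
  -- distinct.
  large-ioct : ∀ S → IndependentOddCycleTransversal (finite G) S → N ≤ ∣ S ∣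
  large-ioct S (indep , d , d-proper) with atMost-∈ S
  ... | xs , xs≤ , S⊆xs = ≤-trans (injective⇒≤length (λ j → enc (inj₂ (j , proj₁ (hit j))))
      (λ e → cong proj₁ (inj₂-injective (trans (sym (decode-encode _)) (trans (cong dec e) (decode-encode _)))))
      λ j → S⊆xs _ (proj₂ (hit j))) xs≤
    where
    shade : ∀ {v} → Dec (v ∈ˢ S) → Fin 3
    shade (yes _) = zero
    shade (no v∉) = suc (d (_ , v∉))
    shade-proper : ∀ {u v} (u∈? : Dec (u ∈ˢ S)) (v∈? : Dec (v ∈ˢ S)) → _~_ (finite G) u v → shade u∈? ≢ shade v∈?
    shade-proper (yes u∈) (yes v∈) uv _ = indep _ _ u∈ v∈ uv
    shade-proper (no u∉)  (no v∉)  uv e = d-proper (_ , u∉) (_ , v∉) uv (suc-injective e)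
    shade-∈ : ∀ {v} (v∈? : Dec (v ∈ˢ S)) → shade v∈? ≡ zero → v ∈ˢ S
    shade-∈ (yes v∈) _ = v∈
    proper : Proper G (λ v → shade (enc v ∈ˢ? S))
    proper u v uv = shade-proper (enc u ∈ˢ? S) (enc v ∈ˢ? S)
      (subst₂ (_~_ G) (sym (decode-encode u)) (sym (decode-encode v)) uv)
    hit : ∀ j → ∃[ q ] (enc (inj₂ (j , q)) ∈ˢ S)
    hit j = decidable-stable (any? λ q → enc (inj₂ (j , q)) ∈ˢ? S) λ none →
      ubiquitous proper zero j λ q e → none (q , shade-∈ (enc (inj₂ (j , q)) ∈ˢ? S) e)

family-unbounded : ∀ (F : Family) {n} {H : Graph (Fin n)} → (∀ N → (H -Free) (Family.graph F N)) →
                   ¬ IoctBounded (FreeThreeColourable H)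
family-unbounded F {H = H} free = unbounded {FreeThreeColourable H} core λ N →
  core + N * layer , finite (graph N) ,
  (free N ∘ (λ H⊴ → ⊴-trans {F = H} {finite (graph N)} {graph N} H⊴ (finite-⊴ {G = graph N})) , Member.colourable F N) ,
  Member.colourable F N , Member.small-oct F N , Member.large-ioct F N
  where open Family F

-- Layered graphs described by finite lists of edges.

Edges : Set
Edges = List (ℕ × ℕ)

joins : Edges → ℕ → ℕ → Bool
joins []            i j = false
joins ((x , y) ∷ E) i j = ((i ≡ᵇ x) ∧ (j ≡ᵇ y)) ∨ ((i ≡ᵇ y) ∧ (j ≡ᵇ x)) ∨ joins E i j

joins-sym : ∀ E i j → joins E i j ≡ joins E j i
joins-sym []            i j = refl
joins-sym ((x , y) ∷ E) i j rewrite joins-sym E i j with (i ≡ᵇ x) ∧ (j ≡ᵇ y) in p | (i ≡ᵇ y) ∧ (j ≡ᵇ x) in q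
... | b | b′ rewrite ∧-comm (j ≡ᵇ x) (i ≡ᵇ y) | ∧-comm (j ≡ᵇ y) (i ≡ᵇ x) | p | q with b | b′
...   | true  | true  = refl
...   | true  | false = refl
...   | false | true  = refl
...   | false | false = refl

-- The vertex types of a layered graph, numbered from 0 with the core first.
module Blowup (a b : ℕ) (E : Edges) (irrefl : ∀ (i : Fin (a + b)) → joins E (toℕ i) (toℕ i) ≡ false) where

  type : ∀ {N} → Vertices a b N → Fin (a + b)
  type (inj₁ p)       = p ↑ˡ b
  type (inj₂ (_ , q)) = a ↑ʳ q

  infix 4 _—_
  _—_ : Rel (Fin (a + b)) 0ℓ
  i — j = joins E (toℕ i) (toℕ j) ≡ true

  _—?_ : B.Decidable _—_
  i —? j = joins E (toℕ i) (toℕ j) ≟ᵇ true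

  -- Vertices of one type are twins, even across layers. A pattern given by adjacencies and
  -- non-adjacencies alone is thus excluded for every `N` by a finite check on types.
  blowup : ∀ N → Graph (Vertices a b N)
  blowup N ._~_ u v = type u — type v
  blowup N .~-sym {u} {v} = trans (joins-sym E (toℕ (type v)) (toℕ (type u)))
  blowup N .~-irrefl {u} refl e = contradiction (trans (sym e) (irrefl (type u))) λ ()
  blowup N ._~?_ u v = type u —? type v

  SameLayer : ∀ {N} → Rel (Vertices a b N) 0ℓ
  SameLayer (inj₂ (i , _)) (inj₂ (j , _)) = i ≡ j
  SameLayer _              _              = ⊤

  sameLayer? : ∀ {N} → B.Decidable (SameLayer {N})
  sameLayer? (inj₂ (i , _)) (inj₂ (j , _)) = i ≟ᶠ j
  sameLayer? (inj₁ _)       _              = yes tt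
  sameLayer? (inj₂ _)       (inj₁ _)       = yes tt

  sameLayer-sym : ∀ {N} → B.Symmetric (SameLayer {N})
  sameLayer-sym {x = inj₁ _} {inj₁ _} _ = tt
  sameLayer-sym {x = inj₁ _} {inj₂ _} _ = tt
  sameLayer-sym {x = inj₂ _} {inj₁ _} _ = tt
  sameLayer-sym {x = inj₂ _} {inj₂ _} e = sym e

  -- Here the layers are disjoint copies with no edges between them, each attached to the core.
  copied : ∀ N → Graph (Vertices a b N)
  copied N ._~_ u v = type u — type v × SameLayer u v
  copied N .~-sym {u} {v} (e , l) = ~-sym (blowup N) {u} {v} e , sameLayer-sym {x = u} {v} l
  copied N .~-irrefl {u} e (uv , _) = ~-irrefl (blowup N) e uv
  copied N ._~?_ u v = (type u —? type v) ×-dec sameLayer? u v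

proper? : ∀ {k m} {R : Rel (Fin k) 0ℓ} (R? : B.Decidable R) (c : Fin k → Fin m) → Dec (∀ i j → R i j → c i ≢ c j)
proper? R? c = all? λ i → all? λ j → R? i j →-dec ¬? (c i ≟ᶠ c j)

pentagon : ∀ (i a b c d e : Fin 3) → a ≢ i → b ≢ i → c ≢ i → d ≢ i → e ≢ i →
           a ≢ b → b ≢ c → c ≢ d → d ≢ e → e ≢ a → ⊥
pentagon = from-yes (all? {n = 3} λ i → all? {n = 3} λ a → all? {n = 3} λ b → all? {n = 3} λ c → all? {n = 3} λ d → all? {n = 3} λ e →
  ¬? (a ≟ᶠ i) →-dec (¬? (b ≟ᶠ i) →-dec (¬? (c ≟ᶠ i) →-dec (¬? (d ≟ᶠ i) →-dec (¬? (e ≟ᶠ i) →-dec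
  (¬? (a ≟ᶠ b) →-dec (¬? (b ≟ᶠ c) →-dec (¬? (c ≟ᶠ d) →-dec (¬? (d ≟ᶠ e) →-dec (¬? (e ≟ᶠ a) →-dec no id))))))))))

Claw : ∀ {V : Set} → Rel V 0ℓ → V → Set
Claw R u = ∃[ x ] ∃[ y ] ∃[ z ]
  (R u x × R u y × R u z × (x ≢ y × x ≢ z × y ≢ z) × (¬ R x y × ¬ R x z × ¬ R y z))

-- Distinctness is stated only for non-adjacent vertices with equal neighbourhoods in the pattern:
-- opposite vertices of C₄, and the leaves in `Claw`. In a graph, all other coincidences contradict
-- the listed adjacencies.
NoTriangle NoC₄ NoC₅ No2P₂ NoP₄+P₁ NoAdjacentClaws : ∀ {V : Set} → Rel V 0ℓ → Set
NoTriangle R = ∀ {a b c} → R a b → R b c → R a c → ⊥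
NoC₄ R = ∀ {a b c d} → R a b → R b c → R c d → R d a → ¬ R a c → ¬ R b d → a ≢ c → b ≢ d → ⊥
NoC₅ R = ∀ {a b c d e} → R a b → R b c → R c d → R d e → R e a →
         ¬ R a c → ¬ R b d → ¬ R c e → ¬ R d a → ¬ R e b → ⊥
No2P₂ R = ∀ {a b c d} → R a b → R c d → ¬ R a c → ¬ R a d → ¬ R b c → ¬ R b d → ⊥
NoP₄+P₁ R = ∀ {a b c d e} → R a b → R b c → R c d → ¬ R a c → ¬ R b d → ¬ R a d →
            ¬ R e a → ¬ R e b → ¬ R e c → ¬ R e d → ⊥
NoAdjacentClaws R = ∀ {u v} → R u v → Claw R u → Claw R v → ⊥

NoK₁₅ : ∀ {V : Set} → Rel V 0ℓ → Set
NoK₁₅ {V} R = ∀ {u} (f : Fin 5 → V) → Injective _≡_ _≡_ f → (∀ i → R u (f i)) → (∀ i j → ¬ R (f i) (f j)) → ⊥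

-- A colour class misses one of the adjacent hubs 0 and 1, and hence meets the
-- pentagon 0-2-3-4-5 or 1-3-4-5-6 of every layer.
module Pentagons where

  edges : Edges
  edges = (0 , 1) ∷ (0 , 2) ∷ (0 , 5) ∷ (1 , 3) ∷ (1 , 6) ∷ (2 , 3) ∷ (3 , 4) ∷ (4 , 5) ∷ (5 , 6) ∷ []

  open Blowup 2 5 edges (from-yes (all? {n = 7} λ i → joins edges (toℕ i) (toℕ i) ≟ᵇ false)) public

  colour : Fin 7 → Fin 3
  colour = lookup (1F ∷ 2F ∷ 0F ∷ 1F ∷ 2F ∷ 0F ∷ 1F ∷ [])

  bipartition : Fin 5 → Fin 2
  bipartition = lookup (0F ∷ 1F ∷ 0F ∷ 1F ∷ 0F ∷ [])

  family : Family
  family = record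
    { core = 2 ; layer = 5 ; graph = blowup
    ; colouring = λ N → colour ∘ type , λ u v → from-yes (proper? _—?_ colour) (type u) (type v)
    ; parity = λ N → bipartition ∘ proj₂ , λ x y →
        from-yes (proper? (λ q r → (2 ↑ʳ q) —? (2 ↑ʳ r)) bipartition) (proj₂ x) (proj₂ y)
    ; ubiquitous = ubiquitous }
    where
    ubiquitous : ∀ {N} {c : Vertices 2 5 N → Fin 3} → Proper (blowup N) c → ∀ i j → ¬ (∀ q → c (inj₂ (j , q)) ≢ i)
    ubiquitous {N} {c} proper i j avoids = cases (c (inj₁ 0F) ≟ᶠ i)
      where
      cases : Dec (c (inj₁ 0F) ≡ i) → ⊥
      cases (no c0≢i) = pentagon i _ _ _ _ _ c0≢i (avoids 0F) (avoids 1F) (avoids 2F) (avoids 3F)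
            (proper (inj₁ 0F) (inj₂ (j , 0F)) refl) (proper (inj₂ (j , 0F)) (inj₂ (j , 1F)) refl) (proper (inj₂ (j , 1F)) (inj₂ (j , 2F)) refl)
            (proper (inj₂ (j , 2F)) (inj₂ (j , 3F)) refl) (proper (inj₂ (j , 3F)) (inj₁ 0F) refl)
      cases (yes c0≡i) = pentagon i _ _ _ _ _ (λ e → proper (inj₁ 1F) (inj₁ 0F) refl (trans e (sym c0≡i))) (avoids 1F) (avoids 2F) (avoids 3F) (avoids 4F)
            (proper (inj₁ 1F) (inj₂ (j , 1F)) refl) (proper (inj₂ (j , 1F)) (inj₂ (j , 2F)) refl) (proper (inj₂ (j , 2F)) (inj₂ (j , 3F)) refl)
            (proper (inj₂ (j , 3F)) (inj₂ (j , 4F)) refl) (proper (inj₂ (j , 4F)) (inj₁ 1F) refl)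

  noTriangle : ∀ {N} → NoTriangle (_~_ (blowup N))
  noTriangle {a = a} {b} {c} = from-yes (all? λ i → all? λ j → all? λ k → (i —? j) →-dec ((j —? k) →-dec ((i —? k) →-dec no id)))
    (type a) (type b) (type c)

-- The join of an independent set 2 with a double star with centres 0, 1 and
-- leaves 3, 4.
module DoubleStar where

  edges : Edges
  edges = (0 , 1) ∷ (2 , 3) ∷ (2 , 4) ∷ (2 , 0) ∷ (2 , 1) ∷ (0 , 4) ∷ (1 , 3) ∷ []

  open Blowup 2 3 edges (from-yes (all? {n = 5} λ i → joins edges (toℕ i) (toℕ i) ≟ᵇ false)) public

  colour : Fin 5 → Fin 3
  colour = lookup (1F ∷ 2F ∷ 0F ∷ 1F ∷ 2F ∷ [])

  bipartition : Fin 3 → Fin 2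
  bipartition = lookup (0F ∷ 1F ∷ 1F ∷ [])

  family : Family
  family = record
    { core = 2 ; layer = 3 ; graph = blowup
    ; colouring = λ N → colour ∘ type , λ u v → from-yes (proper? _—?_ colour) (type u) (type v)
    ; parity = λ N → bipartition ∘ proj₂ , λ x y →
        from-yes (proper? (λ q r → (2 ↑ʳ q) —? (2 ↑ʳ r)) bipartition) (proj₂ x) (proj₂ y)
    ; ubiquitous = ubiquitous }
    where
    -- A class cannot contain both adjacent hubs. Missing hub 0 it must meet the triangle 0-2-4
    -- inside the layer, missing hub 1 the triangle 1-2-3.
    ubiquitous : ∀ {N} {c : Vertices 2 3 N → Fin 3} → Proper (blowup N) c → ∀ i j → ¬ (∀ q → c (inj₂ (j , q)) ≢ i)
    ubiquitous {N} {c} proper i j avoids = cases (c (inj₁ 0F) ≟ᶠ i)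
      where
      cases : Dec (c (inj₁ 0F) ≡ i) → ⊥
      cases (no c0≢i) = four-colours i _ _ _ (≢-sym c0≢i) (≢-sym (avoids 0F)) (≢-sym (avoids 2F))
            (proper (inj₁ 0F) (inj₂ (j , 0F)) refl) (proper (inj₁ 0F) (inj₂ (j , 2F)) refl) (proper (inj₂ (j , 0F)) (inj₂ (j , 2F)) refl)
      cases (yes c0≡i) = four-colours i _ _ _ (λ e → proper (inj₁ 0F) (inj₁ 1F) refl (trans c0≡i e)) (≢-sym (avoids 0F)) (≢-sym (avoids 1F))
            (proper (inj₁ 1F) (inj₂ (j , 0F)) refl) (proper (inj₁ 1F) (inj₂ (j , 1F)) refl) (proper (inj₂ (j , 0F)) (inj₂ (j , 1F)) refl)

  no2P₂ : ∀ {N} → No2P₂ (_~_ (blowup N))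
  no2P₂ {a = a} {b} {c} {d} = from-yes (all? λ i → all? λ j → all? λ k → all? λ l →
    (i —? j) →-dec ((k —? l) →-dec (¬? (i —? k) →-dec (¬? (i —? l) →-dec (¬? (j —? k) →-dec (¬? (j —? l) →-dec no id))))))
    (type a) (type b) (type c) (type d)

  noP₄+P₁ : ∀ {N} → NoP₄+P₁ (_~_ (blowup N))
  noP₄+P₁ {a = a} {b} {c} {d} {e} = from-yes (all? λ i → all? λ j → all? λ k → all? λ l → all? λ m →
    (i —? j) →-dec ((j —? k) →-dec ((k —? l) →-dec (¬? (i —? k) →-dec (¬? (j —? l) →-dec (¬? (i —? l) →-dec
    (¬? (m —? i) →-dec (¬? (m —? j) →-dec (¬? (m —? k) →-dec (¬? (m —? l) →-dec no id))))))))))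
    (type a) (type b) (type c) (type d) (type e)

  noC₅ : ∀ {N} → NoC₅ (_~_ (blowup N))
  noC₅ {a = a} {b} {c} {d} {e} = from-yes (all? λ i → all? λ j → all? λ k → all? λ l → all? λ m →
    (i —? j) →-dec ((j —? k) →-dec ((k —? l) →-dec ((l —? m) →-dec ((m —? i) →-dec
    (¬? (i —? k) →-dec (¬? (j —? l) →-dec (¬? (k —? m) →-dec (¬? (l —? i) →-dec (¬? (m —? j) →-dec no id))))))))))
    (type a) (type b) (type c) (type d) (type e)

-- The diamond 0-1-2-3 forces hubs 0 and 3 to have equal colours, hence hubs 0
-- and 4 to have different ones; each layer puts a triangle on 0 and on 4.
module Triangles where

  edges : Edges
  edges = (0 , 1) ∷ (0 , 2) ∷ (1 , 2) ∷ (1 , 3) ∷ (2 , 3) ∷ (3 , 4) ∷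
          (0 , 5) ∷ (0 , 6) ∷ (5 , 6) ∷ (4 , 7) ∷ (4 , 8) ∷ (7 , 8) ∷ []

  open Blowup 5 4 edges (from-yes (all? {n = 9} λ i → joins edges (toℕ i) (toℕ i) ≟ᵇ false)) public

  colour : Fin 9 → Fin 3
  colour = lookup (0F ∷ 1F ∷ 2F ∷ 0F ∷ 1F ∷ 1F ∷ 2F ∷ 0F ∷ 2F ∷ [])

  bipartition : Fin 4 → Fin 2
  bipartition = lookup (0F ∷ 1F ∷ 0F ∷ 1F ∷ [])

  family : Family
  family = record
    { core = 5 ; layer = 4 ; graph = copied
    ; colouring = λ N → colour ∘ type , λ u v uv → from-yes (proper? _—?_ colour) (type u) (type v) (proj₁ uv)
    ; parity = λ N → bipartition ∘ proj₂ , λ x y xy →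
        from-yes (proper? (λ q r → (5 ↑ʳ q) —? (5 ↑ʳ r)) bipartition) (proj₂ x) (proj₂ y) (proj₁ xy)
    ; ubiquitous = ubiquitous }
    where
    ubiquitous : ∀ {N} {c : Vertices 5 4 N → Fin 3} → Proper (copied N) c → ∀ i j → ¬ (∀ q → c (inj₂ (j , q)) ≢ i)
    ubiquitous {N} {c} proper i j avoids = cases (c (inj₁ 0F) ≟ᶠ i) (c (inj₁ 4F) ≟ᶠ i)
      where
      cases : Dec (c (inj₁ 0F) ≡ i) → Dec (c (inj₁ 4F) ≡ i) → ⊥
      cases (no c0≢i) _ = four-colours i _ _ _ (≢-sym c0≢i) (≢-sym (avoids 0F)) (≢-sym (avoids 1F))
        (proper (inj₁ 0F) (inj₂ (j , 0F)) (refl , tt)) (proper (inj₁ 0F) (inj₂ (j , 1F)) (refl , tt))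
        (proper (inj₂ (j , 0F)) (inj₂ (j , 1F)) (refl , refl))
      cases (yes _) (no c4≢i) = four-colours i _ _ _ (≢-sym c4≢i) (≢-sym (avoids 2F)) (≢-sym (avoids 3F))
        (proper (inj₁ 4F) (inj₂ (j , 2F)) (refl , tt)) (proper (inj₁ 4F) (inj₂ (j , 3F)) (refl , tt))
        (proper (inj₂ (j , 2F)) (inj₂ (j , 3F)) (refl , refl))
      cases (yes c0≡i) (yes c4≡i) = four-colours i (c (inj₁ 1F)) (c (inj₁ 2F)) (c (inj₁ 3F))
        (λ e → proper (inj₁ 0F) (inj₁ 1F) (refl , tt) (trans c0≡i e)) (λ e → proper (inj₁ 0F) (inj₁ 2F) (refl , tt) (trans c0≡i e))
        (λ e → proper (inj₁ 4F) (inj₁ 3F) (refl , tt) (trans c4≡i e))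
        (proper (inj₁ 1F) (inj₁ 2F) (refl , tt)) (proper (inj₁ 1F) (inj₁ 3F) (refl , tt)) (proper (inj₁ 2F) (inj₁ 3F) (refl , tt))

  private
    κ : Fin 5 → Fin 9
    κ p = p ↑ˡ 4

    ι : Fin 4 → Fin 9
    ι q = 5 ↑ʳ q

    unique-hub : ∀ q p r → ι q — κ p → ι q — κ r → p ≡ r
    unique-hub = from-yes (all? λ q → all? λ p → all? λ r → (ι q —? κ p) →-dec ((ι q —? κ r) →-dec (p ≟ᶠ r)))

    hub-partner : ∀ q p r → ι q — κ p → ι q — ι r → κ p — ι r
    hub-partner = from-yes (all? λ q → all? λ p → all? λ r → (ι q —? κ p) →-dec ((ι q —? ι r) →-dec (κ p —? ι r)))

    unique-partner : ∀ q p r → ι q — ι p → ι q — ι r → p ≡ r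
    unique-partner = from-yes (all? λ q → all? λ p → all? λ r → (ι q —? ι p) →-dec ((ι q —? ι r) →-dec (p ≟ᶠ r)))

    core-noC₄ : ∀ a b c d → κ a — κ b → κ b — κ c → κ c — κ d → κ d — κ a → ¬ κ a — κ c → ¬ κ b — κ d → a ≢ c → b ≢ d → ⊥
    core-noC₄ = from-yes (all? λ a → all? λ b → all? λ c → all? λ d →
      (κ a —? κ b) →-dec ((κ b —? κ c) →-dec ((κ c —? κ d) →-dec ((κ d —? κ a) →-dec
      (¬? (κ a —? κ c) →-dec (¬? (κ b —? κ d) →-dec (¬? (a ≟ᶠ c) →-dec (¬? (b ≟ᶠ d) →-dec no id))))))))

    inner-in-core : ∀ p q → p ≢ 0F → p ≢ 4F → κ p — ι q → ⊥
    inner-in-core = from-yes (all? λ p → all? λ q → ¬? (p ≟ᶠ 0F) →-dec (¬? (p ≟ᶠ 4F) →-dec ((κ p —? ι q) →-dec no id)))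

    core-noClaw : ∀ p x y z → p ≢ 0F → p ≢ 4F → κ p — κ x → κ p — κ y → κ p — κ z → x ≢ y → x ≢ z → y ≢ z →
                  ¬ κ x — κ y → ¬ κ x — κ z → ¬ κ y — κ z → ⊥
    core-noClaw = from-yes (all? λ p → all? λ x → all? λ y → all? λ z →
      ¬? (p ≟ᶠ 0F) →-dec (¬? (p ≟ᶠ 4F) →-dec ((κ p —? κ x) →-dec ((κ p —? κ y) →-dec ((κ p —? κ z) →-dec
      (¬? (x ≟ᶠ y) →-dec (¬? (x ≟ᶠ z) →-dec (¬? (y ≟ᶠ z) →-dec
      (¬? (κ x —? κ y) →-dec (¬? (κ x —? κ z) →-dec (¬? (κ y —? κ z) →-dec no id)))))))))))

  module _ {N : ℕ} where

    infix 4 _≈_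
    _≈_ : Rel (Vertices 5 4 N) 0ℓ
    _≈_ = _~_ (copied N)

    ≈-sym : ∀ u v → u ≈ v → v ≈ u
    ≈-sym u v = ~-sym (copied N) {u} {v}

    -- The only neighbours of a layer vertex are its hub and its partner, which are adjacent. A
    -- vertex of an induced C₄ and the centre of a claw both have two non-adjacent neighbours, so
    -- layer vertices are ruled out for every `N`. A check on types would not do, since these
    -- patterns demand distinct vertices.
    simplicial : ∀ x u v → inj₂ x ≈ u → inj₂ x ≈ v → u ≢ v → u ≈ v
    simplicial (_ , q) (inj₁ p) (inj₁ r) (xu , _) (xv , _) u≢v = ⊥-elim (u≢v (cong inj₁ (unique-hub q p r xu xv)))
    simplicial (_ , q) (inj₁ p) (inj₂ (_ , r)) (xu , _) (xv , _) _ = hub-partner q p r xu xv , tt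
    simplicial x (inj₂ u) (inj₁ r) xu xv u≢v = ≈-sym (inj₁ r) (inj₂ u) (simplicial x (inj₁ r) (inj₂ u) xv xu (≢-sym u≢v))
    simplicial (j , q) (inj₂ (_ , p)) (inj₂ (_ , r)) (xu , refl) (xv , refl) u≢v =
      ⊥-elim (u≢v (cong (λ p → inj₂ (j , p)) (unique-partner q p r xu xv)))

    noC₄ : NoC₄ _≈_
    noC₄ {inj₂ a} {b} {c} {d} ab bc cd da ¬ac ¬bd a≢c b≢d = ¬bd (simplicial a b d ab (≈-sym d (inj₂ a) da) b≢d)
    noC₄ {a} {inj₂ b} {c} {d} ab bc cd da ¬ac ¬bd a≢c b≢d = ¬ac (simplicial b a c (≈-sym a (inj₂ b) ab) bc a≢c)
    noC₄ {a} {b} {inj₂ c} {d} ab bc cd da ¬ac ¬bd a≢c b≢d = ¬bd (simplicial c b d (≈-sym b (inj₂ c) bc) cd b≢d)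
    noC₄ {a} {b} {c} {inj₂ d} ab bc cd da ¬ac ¬bd a≢c b≢d = ¬ac (simplicial d a c da (≈-sym c (inj₂ d) cd) a≢c)
    noC₄ {inj₁ a} {inj₁ b} {inj₁ c} {inj₁ d} ab bc cd da ¬ac ¬bd a≢c b≢d =
      core-noC₄ a b c d (proj₁ ab) (proj₁ bc) (proj₁ cd) (proj₁ da)
        (λ e → ¬ac (e , tt)) (λ e → ¬bd (e , tt)) (a≢c ∘ cong inj₁) (b≢d ∘ cong inj₁)

    Hub : Vertices 5 4 N → Set
    Hub u = u ≡ inj₁ 0F ⊎ u ≡ inj₁ 4F

    -- A core vertex other than the hubs has no neighbours in the layers, and its
    -- neighbours in the core do not contain three independent vertices.
    claw-hub : ∀ u → Claw _≈_ u → Hub u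
    claw-hub (inj₂ u) (x , y , z , ux , uy , uz , (x≢y , _) , (¬xy , _)) = ⊥-elim (¬xy (simplicial u x y ux uy x≢y))
    claw-hub (inj₁ p) (x , y , z , ux , uy , uz , (x≢y , x≢z , y≢z) , (¬xy , ¬xz , ¬yz)) = hub (p ≟ᶠ 0F) (p ≟ᶠ 4F)
      where
      inner : p ≢ 0F → p ≢ 4F → ∀ x y z → inj₁ p ≈ x → inj₁ p ≈ y → inj₁ p ≈ z →
              x ≢ y → x ≢ z → y ≢ z → ¬ x ≈ y → ¬ x ≈ z → ¬ y ≈ z → ⊥
      inner p≢0 p≢4 (inj₂ (_ , q)) _ _ e _ _ _ _ _ _ _ _ = inner-in-core p q p≢0 p≢4 (proj₁ e)
      inner p≢0 p≢4 _ (inj₂ (_ , q)) _ _ e _ _ _ _ _ _ _ = inner-in-core p q p≢0 p≢4 (proj₁ e)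
      inner p≢0 p≢4 _ _ (inj₂ (_ , q)) _ _ e _ _ _ _ _ _ = inner-in-core p q p≢0 p≢4 (proj₁ e)
      inner p≢0 p≢4 (inj₁ x) (inj₁ y) (inj₁ z) px py pz x≢y x≢z y≢z ¬xy ¬xz ¬yz =
        core-noClaw p x y z p≢0 p≢4 (proj₁ px) (proj₁ py) (proj₁ pz) (x≢y ∘ cong inj₁) (x≢z ∘ cong inj₁) (y≢z ∘ cong inj₁)
          (λ e → ¬xy (e , tt)) (λ e → ¬xz (e , tt)) (λ e → ¬yz (e , tt))
      hub : Dec (p ≡ 0F) → Dec (p ≡ 4F) → Hub (inj₁ p)
      hub (yes e) _ = inj₁ (cong inj₁ e)
      hub (no _) (yes e) = inj₂ (cong inj₁ e)
      hub (no p≢0) (no p≢4) = ⊥-elim (inner p≢0 p≢4 x y z ux uy uz x≢y x≢z y≢z ¬xy ¬xz ¬yz)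

    noAdjacentClaws : NoAdjacentClaws _≈_
    noAdjacentClaws {u} {v} uv cu cv = apart (claw-hub u cu) (claw-hub v cv) (proj₁ uv)
      where
      apart : Hub u → Hub v → type u — type v → ⊥
      apart (inj₁ refl) (inj₁ refl) ()
      apart (inj₁ refl) (inj₂ refl) ()
      apart (inj₂ refl) (inj₁ refl) ()
      apart (inj₂ refl) (inj₂ refl) ()

third-colour : ∀ (a b c d : Fin 3) → a ≢ b → a ≢ c → b ≢ c → d ≢ a → d ≢ b → d ≡ c
third-colour = from-yes (all? {n = 3} λ a → all? {n = 3} λ b → all? {n = 3} λ c → all? {n = 3} λ d →
  ¬? (a ≟ᶠ b) →-dec (¬? (a ≟ᶠ c) →-dec (¬? (b ≟ᶠ c) →-dec (¬? (d ≟ᶠ a) →-dec (¬? (d ≟ᶠ b) →-dec (d ≟ᶠ c))))))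

-- The cylinder C₆ × P with the innermost hexagon completed to an octahedron.  A
-- 3-colouring of the octahedron winds twice around the colours, and winding is
-- inherited by every further hexagon.
module Cylinder where

  next : Fin 6 → Fin 6
  next = lookup (1F ∷ 2F ∷ 3F ∷ 4F ∷ 5F ∷ 0F ∷ [])

  Ring : ℕ → Rel (Fin 6) 0ℓ
  Ring zero    p q = p ≢ q × q ≢ next (next (next p))
  Ring (suc _) p q = q ≡ next p ⊎ p ≡ next q

  ring? : ∀ k → B.Decidable (Ring k)
  ring? zero    p q = ¬? (p ≟ᶠ q) ×-dec ¬? (q ≟ᶠ next (next (next p)))
  ring? (suc _) p q = (q ≟ᶠ next p) ⊎-dec (p ≟ᶠ next q)

  octahedron-sym : ∀ p q → Ring 0 p q → Ring 0 q p
  octahedron-sym = from-yes (all? λ p → all? λ q → ring? 0 p q →-dec ring? 0 q p)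

  ring-sym : ∀ k {p q} → Ring k p q → Ring k q p
  ring-sym zero    = octahedron-sym _ _
  ring-sym (suc _) = Sum.swap

  ring-irrefl : ∀ k p → ¬ Ring k p p
  ring-irrefl zero    = from-yes (all? λ p → ¬? (ring? 0 p p))
  ring-irrefl (suc _) = from-yes (all? λ p → ¬? (ring? 1 p p))

  height : ∀ {N} → Vertices 6 6 N → ℕ
  height (inj₁ _)       = 0
  height (inj₂ (j , _)) = suc (toℕ j)

  place : ∀ {N} → Vertices 6 6 N → Fin 6
  place (inj₁ p)       = p
  place (inj₂ (_ , p)) = p

  height-place : ∀ {N} {u v : Vertices 6 6 N} → height u ≡ height v → place u ≡ place v → u ≡ v
  height-place {u = inj₁ _} {inj₁ _} _ refl = refl
  height-place {u = inj₂ (i , _)} {inj₂ (j , _)} h refl with refl ← toℕ-injective (ℕ.suc-injective h) = refl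

  Adjacent : ∀ {N} → Rel (Vertices 6 6 N) 0ℓ
  Adjacent u v = (height u ≡ height v × Ring (height u) (place u) (place v)) ⊎
                 (place u ≡ place v × (height v ≡ suc (height u) ⊎ height u ≡ suc (height v)))

  cylinder : ∀ N → Graph (Vertices 6 6 N)
  cylinder N ._~_ = Adjacent
  cylinder N .~-sym {u} {v} (inj₁ (h , r)) = inj₁ (sym h , subst (λ k → Ring k (place v) (place u)) h (ring-sym (height u) r))
  cylinder N .~-sym (inj₂ (p , h)) = inj₂ (sym p , Sum.swap h)
  cylinder N .~-irrefl {u} refl (inj₁ (_ , r)) = ring-irrefl (height u) (place u) r
  cylinder N .~-irrefl refl (inj₂ (_ , h)) = [ 1+n≢n ∘ sym , 1+n≢n ∘ sym ] h
  cylinder N ._~?_ u v = ((height u ℕ.≟ height v) ×-dec ring? (height u) (place u) (place v)) ⊎-dec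
                         ((place u ≟ᶠ place v) ×-dec ((height v ℕ.≟ suc (height u)) ⊎-dec (height u ℕ.≟ suc (height v))))

  rotate : Fin 3 → Fin 3
  rotate = lookup (1F ∷ 2F ∷ 0F ∷ [])

  rotate-injective : ∀ i j → rotate i ≡ rotate j → i ≡ j
  rotate-injective = from-yes (all? λ i → all? λ j → (rotate i ≟ᶠ rotate j) →-dec (i ≟ᶠ j))

  flip₂ : Fin 2 → Fin 2
  flip₂ = lookup (1F ∷ 0F ∷ [])

  flip₂-injective : ∀ i j → flip₂ i ≡ flip₂ j → i ≡ j
  flip₂-injective = from-yes (all? λ i → all? λ j → (flip₂ i ≟ᶠ flip₂ j) →-dec (i ≟ᶠ j))

  iter : ∀ {A : Set} → (A → A) → ℕ → A → A
  iter f zero    x = x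
  iter f (suc k) x = f (iter f k x)

  iter-injective : ∀ {A : Set} {f : A → A} → (∀ i j → f i ≡ f j → i ≡ j) → ∀ k {x y} → iter f k x ≡ iter f k y → x ≡ y
  iter-injective f-inj zero    e = e
  iter-injective f-inj (suc k) e = iter-injective f-inj k (f-inj _ _ e)

  colour₃ : Fin 6 → Fin 3
  colour₃ = lookup (0F ∷ 1F ∷ 2F ∷ 0F ∷ 1F ∷ 2F ∷ [])

  colour₂ : Fin 6 → Fin 2
  colour₂ = lookup (0F ∷ 1F ∷ 0F ∷ 1F ∷ 0F ∷ 1F ∷ [])

  colour₃-proper : ∀ k p q → Ring k p q → colour₃ p ≢ colour₃ q
  colour₃-proper zero    = from-yes (all? λ p → all? λ q → ring? 0 p q →-dec ¬? (colour₃ p ≟ᶠ colour₃ q))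
  colour₃-proper (suc _) = from-yes (all? λ p → all? λ q → ring? 1 p q →-dec ¬? (colour₃ p ≟ᶠ colour₃ q))

  colour₂-proper : ∀ p q → Ring 1 p q → colour₂ p ≢ colour₂ q
  colour₂-proper = from-yes (all? λ p → all? λ q → ring? 1 p q →-dec ¬? (colour₂ p ≟ᶠ colour₂ q))

  rotate-≢ : ∀ i → i ≢ rotate i
  rotate-≢ = from-yes (all? λ i → ¬? (i ≟ᶠ rotate i))

  flip₂-≢ : ∀ i → i ≢ flip₂ i
  flip₂-≢ = from-yes (all? λ i → ¬? (i ≟ᶠ flip₂ i))

  -- Going up one level applies `f` to the colouring of the hexagon: injectivity handles edges
  -- within a level, the lack of fixed points those between levels. Rotating three colours gives the
  -- 3-colouring, swapping two gives the bipartition of the layers.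
  twisted : ∀ {A : Set} {f : A → A} → (∀ i j → f i ≡ f j → i ≡ j) → (∀ i → i ≢ f i) →
            ∀ {N} (c : Fin 6 → A) {u v : Vertices 6 6 N} →
            (height u ≡ height v → Ring (height u) (place u) (place v) → c (place u) ≢ c (place v)) →
            Adjacent u v → iter f (height u) (c (place u)) ≢ iter f (height v) (c (place v))
  twisted {f = f} f-inj f-≢ c {u} {v} ring (inj₁ (h , r)) e rewrite sym h = ring refl r (iter-injective f-inj (height u) e)
  twisted {f = f} f-inj f-≢ c {u} {v} ring (inj₂ (p , inj₁ h)) e rewrite p | h = f-≢ _ e
  twisted {f = f} f-inj f-≢ c {u} {v} ring (inj₂ (p , inj₂ h)) e rewrite p | h = f-≢ _ (sym e)

  -- The pattern abcabc around the hexagon; in particular all three colours occur.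
  record Winding (x : Fin 6 → Fin 3) : Set where
    constructor winding
    field
      0≢1 : x 0F ≢ x 1F
      0≢2 : x 0F ≢ x 2F
      1≢2 : x 1F ≢ x 2F
      3≡0 : x 3F ≡ x 0F
      4≡1 : x 4F ≡ x 1F
      5≡2 : x 5F ≡ x 2F

  octahedron-winding : ∀ {x} → (∀ {p q} → Ring 0 p q → x p ≢ x q) → Winding x
  octahedron-winding {x} proper = winding (edge 0F 1F) (edge 0F 2F) (edge 1F 2F)
    (third-colour _ _ _ _ (edge 1F 2F) (edge 1F 0F) (edge 2F 0F) (edge 3F 1F) (edge 3F 2F))
    (third-colour _ _ _ _ (edge 0F 2F) (edge 0F 1F) (edge 2F 1F) (edge 4F 0F) (edge 4F 2F))
    (third-colour _ _ _ _ (edge 0F 1F) (edge 0F 2F) (edge 1F 2F) (edge 5F 0F) (edge 5F 1F))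
    where
    edge : ∀ p q → {{_ : True (ring? 0 p q)}} → x p ≢ x q
    edge p q {{r}} = proper (toWitness r)

  -- If the next hexagon y is shifted by one step at a single place then it is so
  -- all the way around.
  winding-step : ∀ {x y} → Winding x → (∀ {p q} → Ring 1 p q → y p ≢ y q) → (∀ p → y p ≢ x p) → Winding y
  winding-step {x} {y} (winding x₀₁ x₀₂ x₁₂ x₃₀ x₄₁ x₅₂) proper shifted = cases (y 0F ≟ᶠ x 2F)
    where
    edge : ∀ p q → {{_ : True (ring? 1 p q)}} → y p ≢ y q
    edge p q {{r}} = proper (toWitness r)
    at : ∀ p {i} → x p ≡ i → y p ≢ i
    at p refl = shifted p
    near : ∀ p q {i} → {{_ : True (ring? 1 p q)}} → y q ≡ i → y p ≢ i
    near p q refl = edge p q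
    same : ∀ {p q i} → y p ≡ i → y q ≡ i → y p ≡ y q
    same e e′ = trans e (sym e′)
    apart : ∀ {p q i j} → y p ≡ i → y q ≡ j → i ≢ j → y p ≢ y q
    apart refl refl = id
    cases : Dec (y 0F ≡ x 2F) → Winding y
    cases (yes y0) = winding (apart y0 y1 (≢-sym x₀₂)) (apart y0 y2 (≢-sym x₁₂)) (apart y1 y2 x₀₁) (same y3 y0) (same y4 y1) (same y5 y2)
      where
      y1 : y 1F ≡ x 0F
      y1 = third-colour (x 1F) (x 2F) _ _ x₁₂ (≢-sym x₀₁) (≢-sym x₀₂) (at 1F refl) (near 1F 0F y0)
      y2 : y 2F ≡ x 1F
      y2 = third-colour (x 2F) (x 0F) _ _ (≢-sym x₀₂) (≢-sym x₁₂) x₀₁ (at 2F refl) (near 2F 1F y1)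
      y3 : y 3F ≡ x 2F
      y3 = third-colour (x 0F) (x 1F) _ _ x₀₁ x₀₂ x₁₂ (at 3F x₃₀) (near 3F 2F y2)
      y4 : y 4F ≡ x 0F
      y4 = third-colour (x 1F) (x 2F) _ _ x₁₂ (≢-sym x₀₁) (≢-sym x₀₂) (at 4F x₄₁) (near 4F 3F y3)
      y5 : y 5F ≡ x 1F
      y5 = third-colour (x 2F) (x 0F) _ _ (≢-sym x₀₂) (≢-sym x₁₂) x₀₁ (at 5F x₅₂) (near 5F 4F y4)
    -- The shift goes in the other direction here, so the values are forced around the hexagon
    -- backwards, through 5, 4, 3, 2 and 1.
    cases (no y0≢) = winding (apart y0 y1 x₁₂) (apart y0 y2 (≢-sym x₀₁)) (apart y1 y2 (≢-sym x₀₂)) (same y3 y0) (same y4 y1) (same y5 y2)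
      where
      y0 : y 0F ≡ x 1F
      y0 = third-colour (x 0F) (x 2F) _ _ x₀₂ x₀₁ (≢-sym x₁₂) (at 0F refl) y0≢
      y5 : y 5F ≡ x 0F
      y5 = third-colour (x 2F) (x 1F) _ _ (≢-sym x₁₂) (≢-sym x₀₂) (≢-sym x₀₁) (at 5F x₅₂) (near 5F 0F y0)
      y4 : y 4F ≡ x 2F
      y4 = third-colour (x 1F) (x 0F) _ _ (≢-sym x₀₁) x₁₂ x₀₂ (at 4F x₄₁) (near 4F 5F y5)
      y3 : y 3F ≡ x 1F
      y3 = third-colour (x 0F) (x 2F) _ _ x₀₂ x₀₁ (≢-sym x₁₂) (at 3F x₃₀) (near 3F 4F y4)
      y2 : y 2F ≡ x 0F
      y2 = third-colour (x 2F) (x 1F) _ _ (≢-sym x₁₂) (≢-sym x₀₂) (≢-sym x₀₁) (at 2F refl) (near 2F 3F y3)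
      y1 : y 1F ≡ x 2F
      y1 = third-colour (x 1F) (x 0F) _ _ (≢-sym x₀₁) x₁₂ x₀₂ (at 1F refl) (near 1F 2F y2)

  layer-winding : ∀ {N} {c : Vertices 6 6 N → Fin 3} → Proper (cylinder N) c → ∀ j → Winding (λ p → c (inj₂ (j , p)))
  layer-winding {suc N} {c} proper = <-weakInduction _
    (winding-step (octahedron-winding λ r → proper _ _ (inj₁ (refl , r))) (λ r → proper _ _ (inj₁ (refl , r)))
      (λ p → proper (inj₂ (zero , p)) (inj₁ p) (inj₂ (refl , inj₂ refl))))
    (λ j w → winding-step w (λ r → proper _ _ (inj₁ (refl , r)))
      (λ p → proper (inj₂ (suc j , p)) (inj₂ (inject₁ j , p)) (inj₂ (refl , inj₂ (cong (2 +_) (sym (toℕ-inject₁ j)))))))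

  family : Family
  family = record
    { core = 6 ; layer = 6 ; graph = cylinder
    ; colouring = λ N → (λ v → iter rotate (height v) (colour₃ (place v))) ,
        λ u v → twisted rotate-injective rotate-≢ colour₃ {u} {v} (λ _ → colour₃-proper (height u) (place u) (place v))
    ; parity = λ N → (λ x → iter flip₂ (height {N} (inj₂ x)) (colour₂ (proj₂ x))) ,
        λ x y → twisted flip₂-injective flip₂-≢ colour₂ {inj₂ x} {inj₂ y} (λ _ → colour₂-proper (proj₂ x) (proj₂ y))
    ; ubiquitous = λ proper i j avoids → four-colours i _ _ _ (≢-sym (avoids 0F)) (≢-sym (avoids 1F)) (≢-sym (avoids 2F))
        (Winding.0≢1 (layer-winding proper j)) (Winding.0≢2 (layer-winding proper j)) (Winding.1≢2 (layer-winding proper j)) }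

  -- In the octahedron the four neighbours of `p` split into two adjacent pairs, one and two steps
  -- ahead and one and two steps behind. In a later hexagon each half is a single vertex.
  half : ℕ → Fin 6 → Fin 6 → Bool
  half zero    p q = does (q ≟ᶠ next p) ∨ does (q ≟ᶠ next (next p))
  half (suc _) p q = does (q ≟ᶠ next p)

  -- Neighbours with the same label are adjacent, so independent neighbours of a
  -- vertex have different labels.
  label : ∀ {N} {u v : Vertices 6 6 N} → Adjacent u v → Fin 4
  label {u = u} {v} (inj₁ _) = if half (height u) (place u) (place v) then 0F else 1F
  label (inj₂ (_ , inj₁ _))  = 2F
  label (inj₂ (_ , inj₂ _))  = 3F

  same-half : ∀ k p q r → Ring k p q → Ring k p r → half k p q ≡ half k p r → q ≡ r ⊎ Ring k q r
  same-half zero    = from-yes (all? λ p → all? λ q → all? λ r →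
    ring? 0 p q →-dec (ring? 0 p r →-dec ((half 0 p q ≟ᵇ half 0 p r) →-dec ((q ≟ᶠ r) ⊎-dec ring? 0 q r))))
  same-half (suc _) = from-yes (all? λ p → all? λ q → all? λ r →
    ring? 1 p q →-dec (ring? 1 p r →-dec ((half 1 p q ≟ᵇ half 1 p r) →-dec ((q ≟ᶠ r) ⊎-dec ring? 1 q r))))

  same-label : ∀ {N} {u v w : Vertices 6 6 N} (uv : Adjacent u v) (uw : Adjacent u w) →
               label uv ≡ label uw → v ≡ w ⊎ Adjacent v w
  same-label {u = u} {v} {w} (inj₁ (hv , rv)) (inj₁ (hw , rw)) e =
    Sum.map (height-place (trans (sym hv) hw))
            (λ r → inj₁ (trans (sym hv) hw , subst (λ k → Ring k (place v) (place w)) hv r))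
            (same-half (height u) (place u) (place v) (place w) rv rw (halves _ _ e))
    where
    halves : ∀ b b′ → (if b then 0F else 1F) ≡ (Fin 4 ∋ (if b′ then 0F else 1F)) → b ≡ b′
    halves true  true  _ = refl
    halves false false _ = refl
  same-label {u = u} {v} (inj₁ _) (inj₂ (_ , inj₁ _)) e with half (height u) (place u) (place v)
  same-label (inj₁ _) (inj₂ (_ , inj₁ _)) () | true
  same-label (inj₁ _) (inj₂ (_ , inj₁ _)) () | false
  same-label {u = u} {v} (inj₁ _) (inj₂ (_ , inj₂ _)) e with half (height u) (place u) (place v)
  same-label (inj₁ _) (inj₂ (_ , inj₂ _)) () | true
  same-label (inj₁ _) (inj₂ (_ , inj₂ _)) () | false
  same-label {u = u} {w = w} (inj₂ (_ , inj₁ _)) (inj₁ _) e with half (height u) (place u) (place w)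
  same-label (inj₂ (_ , inj₁ _)) (inj₁ _) () | true
  same-label (inj₂ (_ , inj₁ _)) (inj₁ _) () | false
  same-label {u = u} {w = w} (inj₂ (_ , inj₂ _)) (inj₁ _) e with half (height u) (place u) (place w)
  same-label (inj₂ (_ , inj₂ _)) (inj₁ _) () | true
  same-label (inj₂ (_ , inj₂ _)) (inj₁ _) () | false
  same-label (inj₂ (p , inj₁ h)) (inj₂ (p′ , inj₁ h′)) _ = inj₁ (height-place (trans h (sym h′)) (trans (sym p) p′))
  same-label (inj₂ (p , inj₂ h)) (inj₂ (p′ , inj₂ h′)) _ =
    inj₁ (height-place (ℕ.suc-injective (trans (sym h) h′)) (trans (sym p) p′))

  noK₁₅ : ∀ {N} → NoK₁₅ (_~_ (cylinder N))
  noK₁₅ f f-inj adj indep = contradiction (injective⇒≤ {f = label ∘ adj} λ {i} {j} e →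
    [ f-inj , ⊥-elim ∘ indep i j ] (same-label (adj i) (adj j) e)) λ { (s≤s (s≤s (s≤s (s≤s ())))) }

-- The graphs that no family excludes

atMost-label : ∀ {V : Set} {m} {P : Pred V 0ℓ} → AtMost m P →
  ∃ λ (ℓ : ∀ v → P v → Fin m) → ∀ {u v} (p : P u) (q : P v) → ℓ u p ≡ ℓ v q → u ≡ v
atMost-label {V} (xs , le , cov) = (λ v p → inject≤ (index (cov v p)) le) ,
  λ p q e → index-injective (setoid V) (cov _ p) (cov _ q) (inject≤-injective _ _ _ _ e)

module Classify {n : ℕ} (H : Graph (Fin n))
  (noTriangle : NoTriangle (_~_ H)) (noC₄ : NoC₄ (_~_ H)) (noC₅ : NoC₅ (_~_ H))
  (no2P₂ : No2P₂ (_~_ H)) (noP₄+P₁ : NoP₄+P₁ (_~_ H))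
  (noAdjacentClaws : NoAdjacentClaws (_~_ H)) (noK₁₅ : NoK₁₅ (_~_ H)) where

  infix 4 _≈_
  _≈_ : Rel (Fin n) 0ℓ
  _≈_ = _~_ H

  _≈?_ : B.Decidable _≈_
  _≈?_ = _~?_ H

  ≈-sym : ∀ {u v} → u ≈ v → v ≈ u
  ≈-sym = ~-sym H

  ≈⇒≢ : ∀ {u v} → u ≈ v → u ≢ v
  ≈⇒≢ uv e = ~-irrefl H e uv

  neighbours-independent : ∀ {u v w} → u ≈ v → u ≈ w → ¬ v ≈ w
  neighbours-independent uv uw vw = noTriangle uv vw uw

  degree≤4 : ∀ u → ¬ Many 5 (u ≈_)
  degree≤4 u (f , f-inj , uf) = noK₁₅ f f-inj uf λ i j → neighbours-independent (uf i) (uf j)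

  InducedP₄ : Fin n → Fin n → Fin n → Fin n → Set
  InducedP₄ a b c d = a ≈ b × b ≈ c × c ≈ d × ¬ a ≈ c × ¬ b ≈ d × ¬ a ≈ d

  inducedP₄? : ∀ a b c d → Dec (InducedP₄ a b c d)
  inducedP₄? a b c d = (a ≈? b) ×-dec (b ≈? c) ×-dec (c ≈? d) ×-dec ¬? (a ≈? c) ×-dec ¬? (b ≈? d) ×-dec ¬? (a ≈? d)

  reverse : ∀ {a b c d} → InducedP₄ a b c d → InducedP₄ d c b a
  reverse (ab , bc , cd , ¬ac , ¬bd , ¬ad) = ≈-sym cd , ≈-sym bc , ≈-sym ab , ¬bd ∘ ≈-sym , ¬ac ∘ ≈-sym , ¬ad ∘ ≈-sym

  module DoubleStarCase {a b c d : Fin n} (P₄ : InducedP₄ a b c d) where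

    private
      ab  = proj₁ P₄
      bc  = proj₁ (proj₂ P₄)
      cd  = proj₁ (proj₂ (proj₂ P₄))
      ¬ac = proj₁ (proj₂ (proj₂ (proj₂ P₄)))
      ¬bd = proj₁ (proj₂ (proj₂ (proj₂ (proj₂ P₄))))
      ¬ad = proj₂ (proj₂ (proj₂ (proj₂ (proj₂ P₄))))

    -- A vertex seeing neither `b` nor `c` would give C₅ if it sees both ends of the path, 2P₂ if it
    -- sees one, and P₄ + P₁ if it sees none.
    near-centre : ∀ v → v ≈ b ⊎ v ≈ c
    near-centre v with v ≈? b | v ≈? c | v ≈? a | v ≈? d
    ... | yes vb | _ | _ | _ = inj₁ vb
    ... | no _ | yes vc | _ | _ = inj₂ vc
    ... | no ¬vb | no ¬vc | yes va | yes vd = ⊥-elim (noC₅ va ab bc cd (≈-sym vd) ¬vb ¬ac ¬bd (¬vc ∘ ≈-sym) (¬ad ∘ ≈-sym))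
    ... | no ¬vb | no ¬vc | yes va | no ¬vd = ⊥-elim (no2P₂ va cd ¬vc ¬vd ¬ac ¬ad)
    ... | no ¬vb | no ¬vc | no ¬va | yes vd = ⊥-elim (no2P₂ vd ab ¬va ¬vb (¬ad ∘ ≈-sym) (¬bd ∘ ≈-sym))
    ... | no ¬vb | no ¬vc | no ¬va | no ¬vd = ⊥-elim (noP₄+P₁ ab bc cd ¬ac ¬bd ¬ad ¬va ¬vb ¬vc ¬vd)

    -- An edge between a leaf at `b` and a leaf at `c` would close an induced C₄ through b-c.
    leaves-independent : ∀ {u v} → u ≈ b → u ≢ c → v ≈ c → v ≢ b → ¬ u ≈ v
    leaves-independent ub u≢c vc v≢b uv = noC₄ ub bc (≈-sym vc) (≈-sym uv)
      (λ uc → noTriangle ub bc uc) (λ bv → noTriangle bv vc bc) u≢c (≢-sym v≢b)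

    -- The centre c has the single leaf d, so it plays the role of the
    -- subdivision vertex.
    module Star⁺ (only-d : ∀ {v : Fin n} → v ≈ c → v ≢ b → v ≡ d) where

      Leaf : Pred (Fin n) 0ℓ
      Leaf v = v ≈ b × v ≢ c

      few-leaves : AtMost 3 Leaf
      -- Four leaves together with `c` would give `b` degree 5.
      few-leaves = ¬many⇒atMost (λ v → (v ≈? b) ×-dec ¬? (v ≟ᶠ c)) λ { (f , f-inj , leaf) → degree≤4 b
        ( (λ { zero → c ; (suc i) → f i })
        , (λ { {zero} {zero} _ → refl ; {zero} {suc j} e → ⊥-elim (proj₂ (leaf j) (sym e))
             ; {suc i} {zero} e → ⊥-elim (proj₂ (leaf i) e) ; {suc i} {suc j} e → cong suc (f-inj e) })
        , λ { zero → bc ; (suc i) → ≈-sym (proj₁ (leaf i)) }) }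

      ℓ : ∀ v → Leaf v → Fin 3
      ℓ = proj₁ (atMost-label few-leaves)

      data Kind (v : Fin n) : Set where
        is-b : v ≡ b → Kind v
        is-c : v ≡ c → Kind v
        is-d : v ≡ d → Kind v
        leaf : Leaf v → Kind v

      kind : ∀ v → Kind v
      kind v with v ≟ᶠ c | v ≟ᶠ b | near-centre v
      ... | yes e | _     | _       = is-c e
      ... | no _  | yes e | _       = is-b e
      ... | no ≢c | no _  | inj₁ vb = leaf (vb , ≢c)
      ... | no _  | no ≢b | inj₂ vc = is-d (only-d vc ≢b)

      -- `star⁺ 4` subdivides the edge from `zero` to `suc zero`, so `d` has to go to `suc zero`,
      -- and three places are left for the leaves.
      image : ∀ {v} → Kind v → Maybe (Fin 5)
      image (is-b _) = just zero
      image (is-c _) = nothing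
      image (is-d _) = just (suc zero)
      image (leaf l) = just (suc (suc (ℓ _ l)))

      image-injective : ∀ {u v} (ku : Kind u) (kv : Kind v) → image ku ≡ image kv → u ≡ v
      image-injective (is-b refl) (is-b refl) _ = refl
      image-injective (is-c refl) (is-c refl) _ = refl
      image-injective (is-d refl) (is-d refl) _ = refl
      image-injective (leaf l)    (leaf l′)   e = proj₂ (atMost-label few-leaves) l l′ (suc-injective (suc-injective (just-injective e)))

      d≢b : d ≢ b
      d≢b refl = ¬ad ab

      leaf-d : ∀ {u} → Leaf u → ¬ u ≈ d
      leaf-d (ub , u≢c) = leaves-independent ub u≢c (≈-sym cd) d≢b

      image-to : ∀ {u v} (ku : Kind u) (kv : Kind v) → u ≈ v → _~_ (star⁺ 4) (image ku) (image kv)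
      image-to (is-b refl) (is-b refl) e = ⊥-elim (≈⇒≢ e refl)
      image-to (is-b refl) (is-c refl) e = inj₁ refl
      image-to (is-b refl) (is-d refl) e = ⊥-elim (¬bd e)
      image-to (is-b refl) (leaf _)    e = centre-leaf _ , λ { (inj₁ (_ , ())) ; (inj₂ (() , _)) }
      image-to (is-c refl) (is-b refl) e = inj₁ refl
      image-to (is-c refl) (is-c refl) e = ⊥-elim (≈⇒≢ e refl)
      image-to (is-c refl) (is-d refl) e = inj₂ refl
      image-to (is-c refl) (leaf (vb , _)) e = ⊥-elim (noTriangle bc e (≈-sym vb))
      image-to (is-d refl) (is-b refl) e = ⊥-elim (¬bd (≈-sym e))
      image-to (is-d refl) (is-c refl) e = inj₂ refl
      image-to (is-d refl) (is-d refl) e = ⊥-elim (≈⇒≢ e refl)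
      image-to (is-d refl) (leaf l)    e = ⊥-elim (leaf-d l (≈-sym e))
      image-to (leaf _)    (is-b refl) e = leaf-centre _ , λ { (inj₁ (() , _)) ; (inj₂ (() , _)) }
      image-to (leaf (ub , _)) (is-c refl) e = ⊥-elim (noTriangle ub bc e)
      image-to (leaf l)    (is-d refl) e = ⊥-elim (leaf-d l e)
      image-to (leaf (ub , _)) (leaf (vb , _)) e = ⊥-elim (noTriangle e vb ub)

      image-from : ∀ {u v} (ku : Kind u) (kv : Kind v) → _~_ (star⁺ 4) (image ku) (image kv) → u ≈ v
      image-from (is-b refl) (is-c refl) _ = bc
      image-from (is-b refl) (is-d refl) (_ , subdivided) = ⊥-elim (subdivided (inj₁ (refl , refl)))
      image-from (is-b refl) (leaf (vb , _)) _ = ≈-sym vb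
      image-from (is-c refl) (is-b refl) _ = ≈-sym bc
      image-from (is-c refl) (is-d refl) _ = cd
      image-from (is-d refl) (is-b refl) (_ , subdivided) = ⊥-elim (subdivided (inj₂ (refl , refl)))
      image-from (is-d refl) (is-c refl) _ = ≈-sym cd
      image-from (leaf (ub , _)) (is-b refl) _ = ub
      image-from (is-b refl) (is-b refl) (() , _)
      image-from (is-d refl) (is-d refl) (() , _)
      image-from (is-d refl) (leaf _)    (() , _)
      image-from (leaf _)    (is-d refl) (() , _)
      image-from (leaf _)    (leaf _)    (() , _)
      image-from (is-c refl) (leaf _)    (inj₁ ())
      image-from (is-c refl) (leaf _)    (inj₂ ())
      image-from (leaf _)    (is-c refl) (inj₁ ())
      image-from (leaf _)    (is-c refl) (inj₂ ())

      embedding : H ⊴ star⁺ 4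
      embedding = (λ v → image (kind v)) , (λ {u} {v} → image-injective (kind u) (kind v)) ,
                  λ u v → mk⇔ (image-to (kind u) (kind v)) (image-from (kind u) (kind v))

  -- If both centres of the double star had a second leaf, both would be centres
  -- of claws.
  double-star : ∀ {a b c d} → InducedP₄ a b c d → H ⊴ star⁺ 4
  double-star {a} {b} {c} {d} P₄@(ab , bc , cd , ¬ac , ¬bd , ¬ad) =
    cases (any? λ v → second? b c a v) (any? λ v → second? c b d v)
    where
    Second : Fin n → Fin n → Fin n → Fin n → Set
    Second x y z v = v ≈ x × v ≢ y × v ≢ z
    second? : ∀ x y z v → Dec (Second x y z v)
    second? x y z v = (v ≈? x) ×-dec ¬? (v ≟ᶠ y) ×-dec ¬? (v ≟ᶠ z)
    none : ∀ {x y z} → ¬ ∃ (Second x y z) → ∀ {v} → v ≈ x → v ≢ y → v ≡ z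
    none {z = z} ¬second {v} vx v≢y = decidable-stable (v ≟ᶠ z) λ v≢z → ¬second (v , vx , v≢y , v≢z)
    claw : ∀ {x y z v} → x ≈ y → x ≈ z → z ≢ y → Second x y z v → Claw _≈_ x
    claw {x} {y} {z} {v} xy xz z≢y (vx , v≢y , v≢z) =
      y , z , v , xy , xz , ≈-sym vx , (≢-sym z≢y , ≢-sym v≢y , ≢-sym v≢z) ,
      (neighbours-independent xy xz , neighbours-independent xy (≈-sym vx) , neighbours-independent xz (≈-sym vx))
    cases : Dec (∃ (Second b c a)) → Dec (∃ (Second c b d)) → H ⊴ star⁺ 4
    cases _ (no ¬second) = DoubleStarCase.Star⁺.embedding P₄ (none ¬second)
    cases (no ¬second) _ = DoubleStarCase.Star⁺.embedding (reverse P₄) (none ¬second)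
    cases (yes (_ , s)) (yes (_ , t)) = ⊥-elim (noAdjacentClaws bc
      (claw bc (≈-sym ab) (λ { refl → ¬ad cd }) s) (claw (≈-sym bc) cd (λ { refl → ¬ad ab }) t))

  -- All neighbours of `z` have degree 1, so the component of `z` is a star around it.
  Centre : Fin n → Set
  Centre z = ∀ {x y} → x ≈ z → y ≈ x → y ≡ z

  module StarCase {z z₀ : Fin n} (centre : Centre z) (zz₀ : z ≈ z₀) where

    ℓ : ∀ v → z ≈ v → Fin 4
    ℓ = proj₁ (atMost-label (¬many⇒atMost (z ≈?_) (degree≤4 z)))

    data Kind (v : Fin n) : Set where
      is-z     : v ≡ z → Kind v
      leaf     : z ≈ v → Kind v
      isolated : v ≢ z → ¬ z ≈ v → Kind v

    kind : ∀ v → Kind v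
    kind v with v ≟ᶠ z | z ≈? v
    ... | yes e | _      = is-z e
    ... | no _  | yes zv = leaf zv
    ... | no ≢z | no ¬zv = isolated ≢z ¬zv

    -- An edge outside the star would form an induced 2P₂ with the edge from `z` to `z₀`.
    isolated-≉ : ∀ {u v} → u ≢ z → ¬ z ≈ u → ¬ u ≈ v
    isolated-≉ {u} {v} u≢z ¬zu uv with z ≈? v
    ... | yes zv = u≢z (centre (≈-sym zv) uv)
    ... | no ¬zv = no2P₂ zz₀ uv ¬zu ¬zv (λ z₀u → u≢z (centre (≈-sym zz₀) (≈-sym z₀u)))
                     λ z₀v → ¬zu (subst (_≈ u) (centre (≈-sym zz₀) (≈-sym z₀v)) (≈-sym uv))

    -- Each isolated vertex indexes its own copy of `path 1`; taking `n` copies makes it unnecessary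
    -- to count these vertices.
    image : ∀ {v} → Kind v → Fin 5 ⊎ Fin n × Fin 1
    image (is-z _)           = inj₁ zero
    image (leaf zv)          = inj₁ (suc (ℓ _ zv))
    image {v} (isolated _ _) = inj₂ (v , zero)

    image-injective : ∀ {u v} (ku : Kind u) (kv : Kind v) → image ku ≡ image kv → u ≡ v
    image-injective (is-z refl)    (is-z refl)    _    = refl
    image-injective (leaf zu)      (leaf zv)      e    =
      proj₂ (atMost-label (¬many⇒atMost (z ≈?_) (degree≤4 z))) zu zv (suc-injective (inj₁-injective e))
    image-injective (isolated _ _) (isolated _ _) refl = refl

    image-to : ∀ {u v} (ku : Kind u) (kv : Kind v) → u ≈ v → _~_ (star 4 +ᴳ copies n (path 1)) (image ku) (image kv)
    image-to (is-z refl)        (is-z refl)        e = ⊥-elim (≈⇒≢ e refl)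
    image-to (is-z refl)        (leaf _)           e = ⊎.inj₁ (centre-leaf _)
    image-to (leaf _)           (is-z refl)        e = ⊎.inj₁ (leaf-centre _)
    image-to (leaf zu)          (leaf zv)          e = ⊥-elim (neighbours-independent zu zv e)
    image-to (isolated u≢z ¬zu) _                  e = ⊥-elim (isolated-≉ u≢z ¬zu e)
    image-to (is-z refl)        (isolated v≢z ¬zv) e = ⊥-elim (¬zv e)
    image-to (leaf _)           (isolated v≢z ¬zv) e = ⊥-elim (isolated-≉ v≢z ¬zv (≈-sym e))

    image-from : ∀ {u v} (ku : Kind u) (kv : Kind v) → _~_ (star 4 +ᴳ copies n (path 1)) (image ku) (image kv) → u ≈ v
    image-from (is-z refl)    (leaf zv)      _ = zv
    image-from (leaf zu)      (is-z refl)    _ = ≈-sym zu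
    image-from (is-z refl)    (is-z refl)    (⊎.inj₁ ())
    image-from (leaf _)       (leaf _)       (⊎.inj₁ ())
    image-from (isolated _ _) (isolated _ _) (⊎.inj₂ (_ , inj₁ ()))
    image-from (isolated _ _) (isolated _ _) (⊎.inj₂ (_ , inj₂ ()))

    embedding : H ⊴ star 4 +ᴳ copies n (path 1)
    embedding = (λ v → image (kind v)) , (λ {u} {v} → image-injective (kind u) (kind v)) ,
                λ u v → mk⇔ (image-to (kind u) (kind v)) (image-from (kind u) (kind v))

  edgeless : (∀ u v → ¬ u ≈ v) → H ⊴ star 4 +ᴳ copies n (path 1)
  edgeless none = (λ v → inj₂ (v , zero)) , (λ { refl → refl }) ,
    λ u v → mk⇔ (⊥-elim ∘ none u v) λ { (⊎.inj₂ (_ , inj₁ ())) ; (⊎.inj₂ (_ , inj₂ ())) }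

  -- If `u` has a second neighbour, `u` is the centre: a walk u-x-y to another vertex, prolonged by
  -- a neighbour of `u` other than `x`, is an induced P₄ or closes to a C₄. If `v` is the only
  -- neighbour of `u`, then `v` is the centre, as a walk leaving `v` by two steps would extend the
  -- edge u-v to an induced P₄.
  find-centre : (∀ a b c d → ¬ InducedP₄ a b c d) → ∀ {u v} → u ≈ v → ∃[ z ] ∃[ z₀ ] (Centre z × z ≈ z₀)
  find-centre noP₄ {u} {v} uv with any? (λ w → (u ≈? w) ×-dec ¬? (w ≟ᶠ v))
  ... | yes (w , uw , w≢v) = u , v , centre , uv
    where
    another : ∀ x → ∃[ w′ ] (u ≈ w′ × w′ ≢ x)
    another x with w ≟ᶠ x
    ... | yes refl = v , uv , ≢-sym w≢v
    ... | no w≢x   = w , uw , w≢x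
    centre : Centre u
    centre {x} {y} xu yx with another x
    ... | w′ , uw′ , w′≢x = decidable-stable (y ≟ᶠ u) λ y≢u →
      let ¬w′x = λ w′x → noTriangle uw′ w′x (≈-sym xu)
          ¬uy  = λ uy → noTriangle uy yx (≈-sym xu)
      in noP₄ w′ u x y (≈-sym uw′ , ≈-sym xu , ≈-sym yx , ¬w′x , ¬uy ,
           λ w′y → noC₄ (≈-sym uw′) (≈-sym xu) (≈-sym yx) (≈-sym w′y) ¬w′x ¬uy w′≢x (≢-sym y≢u))
  ... | no ¬w = v , u , centre , ≈-sym uv
    where
    only-v : ∀ {x} → u ≈ x → x ≡ v
    only-v {x} ux = decidable-stable (x ≟ᶠ v) λ x≢v → ¬w (x , ux , x≢v)
    centre : Centre v
    centre {x} {y} xv yx with x ≟ᶠ u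
    ... | yes refl = only-v (≈-sym yx)
    ... | no x≢u   = decidable-stable (y ≟ᶠ v) λ y≢v →
      noP₄ u v x y (uv , ≈-sym xv , ≈-sym yx , (λ ux → ≈⇒≢ xv (only-v ux)) , (λ vy → noTriangle vy yx (≈-sym xv)) ,
        λ uy → y≢v (only-v uy))

  classify : H ⊴ star⁺ 4 ⊎ (∃[ s ] H ⊴ star 4 +ᴳ copies s (path 1))
  classify with any? (λ a → any? λ b → any? λ c → any? λ d → inducedP₄? a b c d)
  ... | yes (_ , _ , _ , _ , P₄) = inj₁ (double-star P₄)
  ... | no ¬P₄ with any? (λ u → any? λ v → u ≈? v)
  ...   | no ¬uv = inj₂ (n , edgeless λ u v uv → ¬uv (u , v , uv))
  ...   | yes (u , v , uv) with find-centre (λ a b c d P₄ → ¬P₄ (a , b , c , d , P₄)) uv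
  ...     | z , z₀ , centre , zz₀ = inj₂ (n , StarCase.embedding centre zz₀)

-- Transfer of excluded patterns to `H`, and the theorem.

module Pullback {U V : Set} (H : Graph U) (G : Graph V) (H⊴G : H ⊴ G) where

  private
    f     = proj₁ H⊴G
    f-inj = proj₁ (proj₂ H⊴G)

    to : ∀ {u v} → _~_ H u v → _~_ G (f u) (f v)
    to = Equivalence.to (proj₂ (proj₂ H⊴G) _ _)

    from : ∀ {u v} → ¬ _~_ H u v → ¬ _~_ G (f u) (f v)
    from ¬uv = ¬uv ∘ Equivalence.from (proj₂ (proj₂ H⊴G) _ _)

  noTriangle : NoTriangle (_~_ G) → NoTriangle (_~_ H)
  noTriangle free ab bc ac = free (to ab) (to bc) (to ac)

  noC₄ : NoC₄ (_~_ G) → NoC₄ (_~_ H)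
  noC₄ free ab bc cd da ¬ac ¬bd a≢c b≢d = free (to ab) (to bc) (to cd) (to da) (from ¬ac) (from ¬bd) (a≢c ∘ f-inj) (b≢d ∘ f-inj)

  noC₅ : NoC₅ (_~_ G) → NoC₅ (_~_ H)
  noC₅ free ab bc cd de ea ¬ac ¬bd ¬ce ¬da ¬eb =
    free (to ab) (to bc) (to cd) (to de) (to ea) (from ¬ac) (from ¬bd) (from ¬ce) (from ¬da) (from ¬eb)

  no2P₂ : No2P₂ (_~_ G) → No2P₂ (_~_ H)
  no2P₂ free ab cd ¬ac ¬ad ¬bc ¬bd = free (to ab) (to cd) (from ¬ac) (from ¬ad) (from ¬bc) (from ¬bd)

  noP₄+P₁ : NoP₄+P₁ (_~_ G) → NoP₄+P₁ (_~_ H)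
  noP₄+P₁ free ab bc cd ¬ac ¬bd ¬ad ¬ea ¬eb ¬ec ¬ed =
    free (to ab) (to bc) (to cd) (from ¬ac) (from ¬bd) (from ¬ad) (from ¬ea) (from ¬eb) (from ¬ec) (from ¬ed)

  noAdjacentClaws : NoAdjacentClaws (_~_ G) → NoAdjacentClaws (_~_ H)
  noAdjacentClaws free uv cu cv = free (to uv) (claw cu) (claw cv)
    where
    claw : ∀ {u} → Claw (_~_ H) u → Claw (_~_ G) (f u)
    claw (x , y , z , ux , uy , uz , (x≢y , x≢z , y≢z) , (¬xy , ¬xz , ¬yz)) =
      f x , f y , f z , to ux , to uy , to uz , (x≢y ∘ f-inj , x≢z ∘ f-inj , y≢z ∘ f-inj) , (from ¬xy , from ¬xz , from ¬yz)

  noK₁₅ : NoK₁₅ (_~_ G) → NoK₁₅ (_~_ H)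
  noK₁₅ free g g-inj ug indep = free (f ∘ g) (g-inj ∘ f-inj) (to ∘ ug) (λ i j → from (indep i j))

-- If `H` contained a pattern that a family avoids, every member of that family would be `H`-free,
-- and the class would be unbounded.
ioctBounded⇒⊴ : ∀ {n} (H : Graph (Fin n)) → IoctBounded (FreeThreeColourable H) →
                H ⊴ star⁺ 4 ⊎ (∃[ s ] H ⊴ star 4 +ᴳ copies s (path 1))
ioctBounded⇒⊴ H bounded = Classify.classify H
  (λ ab bc ac → excluded Pentagons.family λ N H⊴ →
    Pullback.noTriangle H (Pentagons.blowup N) H⊴
      (λ {a} {b} {c} → Pentagons.noTriangle {N} {a} {b} {c}) ab bc ac)
  (λ ab bc cd da ¬ac ¬bd a≢c b≢d → excluded Triangles.family λ N H⊴ →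
    Pullback.noC₄ H (Triangles.copied N) H⊴
      (λ {a} {b} {c} {d} → Triangles.noC₄ {N} {a} {b} {c} {d}) ab bc cd da ¬ac ¬bd a≢c b≢d)
  (λ ab bc cd de ea ¬ac ¬bd ¬ce ¬da ¬eb → excluded DoubleStar.family λ N H⊴ →
    Pullback.noC₅ H (DoubleStar.blowup N) H⊴
      (λ {a} {b} {c} {d} {e} → DoubleStar.noC₅ {N} {a} {b} {c} {d} {e}) ab bc cd de ea ¬ac ¬bd ¬ce ¬da ¬eb)
  (λ ab cd ¬ac ¬ad ¬bc ¬bd → excluded DoubleStar.family λ N H⊴ →
    Pullback.no2P₂ H (DoubleStar.blowup N) H⊴
      (λ {a} {b} {c} {d} → DoubleStar.no2P₂ {N} {a} {b} {c} {d}) ab cd ¬ac ¬ad ¬bc ¬bd)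
  (λ ab bc cd ¬ac ¬bd ¬ad ¬ea ¬eb ¬ec ¬ed → excluded DoubleStar.family λ N H⊴ →
    Pullback.noP₄+P₁ H (DoubleStar.blowup N) H⊴
      (λ {a} {b} {c} {d} {e} → DoubleStar.noP₄+P₁ {N} {a} {b} {c} {d} {e}) ab bc cd ¬ac ¬bd ¬ad ¬ea ¬eb ¬ec ¬ed)
  (λ uv cu cv → excluded Triangles.family λ N H⊴ →
    Pullback.noAdjacentClaws H (Triangles.copied N) H⊴
      (λ {u} {v} → Triangles.noAdjacentClaws {N} {u} {v}) uv cu cv)
  (λ g g-inj ug indep → excluded Cylinder.family λ N H⊴ →
    Pullback.noK₁₅ H (Cylinder.cylinder N) H⊴ Cylinder.noK₁₅ g g-inj ug indep)
  where
  excluded : ∀ (F : Family) → (∀ N → (H -Free) (Family.graph F N)) → ⊥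
  excluded F free = family-unbounded F {H = H} free bounded

theorem5 : ∀ {n : ℕ} (H : Graph (Fin n)) →
    ((H ⊴ path 4 ⊎ (∃[ s ] H ⊴ star 3 +ᴳ copies s (path 1))) →
    IoctBounded (FreeThreeColourable H))
    ×
    (IoctBounded (FreeThreeColourable H) →
    (H ⊴ star⁺ 4 ⊎ (∃[ s ] H ⊴ star 4 +ᴳ copies s (path 1))))
theorem5 H = [ ioctBounded-P₄ {H = H} , (λ { (s , H⊴) → ioctBounded-claw {H = H} H⊴ }) ] , ioctBounded⇒⊴ H
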